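{- Let $m\ge1$ and $B_{m,p}=\frac{1}{p+2}\binom{2p+2}{p+1}m^{p+1}$. Then $$\mathbf N^{\mathcal B}_m(z)=\frac{1}{2mz^2}\sum_{p\ge0}B_{m,p}\left(\sqrt{1-4mz+4mz^{p+2}}-\sqrt{1-4mz}\right)$$ and $$\mathbf E^{\mathcal B}_m(z)=\frac{3}{2mz^2}\sum_{p\ge1}\frac{p}{2p+1}B_{m,p}\left(\sqrt{1-4mz+4mz^{p+2}}-\sqrt{1-4mz}\right).$$
   Context: An $m$-labeled binary tree is a non-empty finite rooted tree with node labels in $\{1,\dots,m\}$ in which every node has an optional left and an optional right child (distinguished); its size is its number of edges; $\mathcal B_{m,n}$ is the set of such trees of size $n$ (so $|\mathcal B_{m,p}|=B_{m,p}$). For such a tree $t$, its minimal dag has as nodes the distinct subtrees of $t$ (subtree = a node with all its descendants) and an edge from the node of a subtree to the node of each of its non-empty left/right subtrees; $\|\mathrm{dag}(t)\|$ is the number of distinct subtrees of $t$ and $|\mathrm{dag}(t)|$ is the sum over distinct subtrees of $t$ of the number of children of their root. Define $\mathbf N^{\mathcal B}_m(z)=\sum_{n\ge0}\big(\sum_{t\in\mathcal B_{m,n}}\|\mathrm{dag}(t)\|\big)z^n$ and $\mathbf E^{\mathcal B}_m(z)=\sum_{n\ge0}\big(\sum_{t\in\mathcal B_{m,n}}|\mathrm{dag}(t)|\big)z^n$. -}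

module Defs where

open import Data.Fin.Base using (Fin; toℕ; fromℕ; inject₁)
import Data.Fin.Properties as Fin
open import Data.Integer.Base using (+_)
open import Data.List.Base using (List; []; _∷_; _++_; map; length; concatMap; cartesianProduct; allFin; upTo; deduplicate)
open import Data.List.Membership.Propositional using (_∈_; find; lose)
open import Data.List.Membership.Propositional.Properties
  using (∈-map⁺; ∈-map⁻; ∈-concatMap⁺; ∈-concatMap⁻; ∈-cartesianProduct⁺; ∈-cartesianProduct⁻; ∈-upTo⁺; ∈-upTo⁻; ∈-allFin)
open import Data.List.Relation.Binary.Disjoint.Propositional using (Disjoint)
open import Data.List.Relation.Unary.All as All using ([])
import Data.List.Relation.Unary.All.Properties as All
open import Data.List.Relation.Unary.AllPairs using ([]; _∷_)
import Data.List.Relation.Unary.AllPairs.Properties as AllPairs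
open import Data.List.Relation.Unary.Any using (here)
open import Data.List.Relation.Unary.Unique.Propositional using (Unique)
import Data.List.Relation.Unary.Unique.Propositional.Properties as Unique
open import Data.Maybe.Base using (Maybe; nothing; just)
open import Data.Maybe.Properties using (just-injective)
open import Data.Nat.Base as ℕ using (ℕ; zero; suc; _≤_; _<_; _∸_; s≤s)
import Data.Nat.Properties as ℕ
open import Data.Nat.ListAction using (sum)
open import Data.Nat.Combinatorics using (_C_)
open import Data.Nat.Induction using (<-rec)
open import Data.Product using (_×_; _,_; ∃-syntax)
open import Data.Rational.Base as ℚ using (ℚ; 0ℚ; 1ℚ; ½)
import Data.Rational.Properties as ℚ
open import Data.Rational.Solver using (module +-*-Solver)
open import Function.Bundles using (_⇔_; mk⇔)
open import Relation.Binary.Definitions using (DecidableEquality)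
open import Relation.Binary.PropositionalEquality
open import Relation.Nullary.Decidable using (yes; no)
open import Algebra.Bundles using (CommutativeRing)

open import Algebra.Properties.Semiring.Sum (CommutativeRing.semiring ℚ.+-*-commutativeRing)
  using (sum-syntax; sum⁺-syntax; sum-init-last; sum-cong-≗)

data Tree (m : ℕ) : Set where
  node : (label : Fin m) (left right : Maybe (Tree m)) → Tree m

private
  variable
    m : ℕ

-- `edges` also counts the edge leading from the parent to an optional child.
size  : Tree m → ℕ
edges : Maybe (Tree m) → ℕ
size (node _ l r) = edges l ℕ.+ edges r
edges nothing  = 0
edges (just t) = suc (size t)

present : Maybe (Tree m) → ℕ
present nothing  = 0
present (just _) = 1

children : Tree m → ℕ
children (node _ l r) = present l ℕ.+ present r

infix 4 _≟_ _≟ᵐ_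

_≟_  : DecidableEquality (Tree m)
_≟ᵐ_ : DecidableEquality (Maybe (Tree m))
node a l r ≟ node b l′ r′ with a Fin.≟ b | l ≟ᵐ l′ | r ≟ᵐ r′
... | yes refl | yes refl | yes refl = yes refl
... | no a≢b   | _        | _        = no λ { refl → a≢b refl }
... | yes _    | no l≢l′  | _        = no λ { refl → l≢l′ refl }
... | yes _    | yes _    | no r≢r′  = no λ { refl → r≢r′ refl }
nothing ≟ᵐ nothing = yes refl
nothing ≟ᵐ just _  = no λ ()
just _  ≟ᵐ nothing = no λ ()
just t  ≟ᵐ just u  with t ≟ u
... | yes refl = yes refl
... | no t≢u   = no λ { refl → t≢u refl }

-- The subtrees rooted at the nodes of a tree, one entry per node.
subtrees  : Tree m → List (Tree m)
subtreesᵐ : Maybe (Tree m) → List (Tree m)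
subtrees t@(node _ l r) = t ∷ subtreesᵐ l ++ subtreesᵐ r
subtreesᵐ nothing  = []
subtreesᵐ (just t) = subtrees t

dagNodes : Tree m → List (Tree m)
dagNodes t = deduplicate _≟_ (subtrees t)

‖dag_‖ : Tree m → ℕ
‖dag t ‖ = length (dagNodes t)

-- The node of a subtree has one outgoing edge per child of its root; the left
-- and right edges count separately even when they have the same target.
∣dag_∣ : Tree m → ℕ
∣dag t ∣ = sum (map children (dagNodes t))

-- For every bound ≥ n, these list the trees with `size` n and the optional
-- trees with `edges` n; the bound only serves termination. See ∈𝓑⇔size and
-- 𝓑-unique for the characterization of the resulting 𝓑.
treesWithin : ∀ m (bound n : ℕ) → List (Tree m)
optsWithin  : ∀ m (bound n : ℕ) → List (Maybe (Tree m))
treesWithin m k n = concatMap (λ i →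
    map (λ (a , l , r) → node a l r)
      (cartesianProduct (allFin m)
        (cartesianProduct (optsWithin m k i) (optsWithin m k (n ∸ i)))))
  (upTo (suc n))
optsWithin m _       zero    = nothing ∷ []
optsWithin m zero    (suc n) = []
optsWithin m (suc k) (suc n) = map just (treesWithin m k n)

𝓑 : ∀ m (n : ℕ) → List (Tree m)
𝓑 m n = treesWithin m n n

toNode : Fin m × Maybe (Tree m) × Maybe (Tree m) → Tree m
toNode (a , l , r) = node a l r

layer : ∀ m (k n i : ℕ) → List (Tree m)
layer m k n i = map toNode (cartesianProduct (allFin m)
  (cartesianProduct (optsWithin m k i) (optsWithin m k (n ∸ i))))

∈layer⁻ : ∀ k n i {t : Tree m} → t ∈ layer m k n i →
          ∃[ a ] ∃[ l ] ∃[ r ] (t ≡ node a l r × l ∈ optsWithin m k i × r ∈ optsWithin m k (n ∸ i))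
∈layer⁻ {m} k n i t∈ with (a , l , r) , p∈ , refl ← ∈-map⁻ toNode t∈
  with _ , lr∈ ← ∈-cartesianProduct⁻ (allFin m) _ p∈
  with l∈ , r∈ ← ∈-cartesianProduct⁻ (optsWithin m k i) _ lr∈
  = a , l , r , refl , l∈ , r∈

trees-sound : ∀ k n {t : Tree m} → t ∈ treesWithin m k n → size t ≡ n
opts-sound  : ∀ k n {o : Maybe (Tree m)} → o ∈ optsWithin m k n → edges o ≡ n
trees-sound {m} k n t∈
  with i , i∈ , t∈′ ← find (∈-concatMap⁻ (layer m k n) {xs = upTo (suc n)} t∈)
  with a , l , r , refl , l∈ , r∈ ← ∈layer⁻ k n i t∈′
  = trans (cong₂ ℕ._+_ (opts-sound k i l∈) (opts-sound k (n ∸ i) r∈))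
          (ℕ.m+[n∸m]≡n (ℕ.≤-pred (∈-upTo⁻ i∈)))
opts-sound _       zero    (here refl) = refl
opts-sound zero    (suc n) ()
opts-sound (suc k) (suc n) o∈ with t , t∈ , refl ← ∈-map⁻ just o∈ = cong suc (trees-sound k n t∈)

trees-complete : ∀ k (t : Tree m) → size t ≤ k → t ∈ treesWithin m k (size t)
opts-complete  : ∀ k (o : Maybe (Tree m)) → edges o ≤ k → o ∈ optsWithin m k (edges o)
trees-complete {m} k (node a l r) ≤k =
  ∈-concatMap⁺ (layer m k (edges l ℕ.+ edges r)) (lose (∈-upTo⁺ (s≤s (ℕ.m≤m+n (edges l) (edges r))))
    (∈-map⁺ toNode (∈-cartesianProduct⁺ (∈-allFin a) (∈-cartesianProduct⁺
      (opts-complete k l (ℕ.m+n≤o⇒m≤o (edges l) ≤k))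
      (subst (λ j → r ∈ optsWithin m k j) (sym (ℕ.m+n∸m≡n (edges l) (edges r)))
        (opts-complete k r (ℕ.m+n≤o⇒n≤o (edges l) ≤k)))))))
opts-complete k       nothing  _        = here refl
opts-complete (suc k) (just t) (s≤s ≤k) = ∈-map⁺ just (trees-complete k t ≤k)

toNode-injective : {x y : Fin m × Maybe (Tree m) × Maybe (Tree m)} → toNode x ≡ toNode y → x ≡ y
toNode-injective refl = refl

layers-disjoint : ∀ k n {i j} → i < j → Disjoint (layer m k n i) (layer m k n j)
layers-disjoint k n {i} {j} i<j (t∈ , t∈′)
  with a , l , r , refl , l∈ , _ ← ∈layer⁻ k n i t∈
  with _ , _ , _ , refl , l∈′ , _ ← ∈layer⁻ k n j t∈′
  = ℕ.<⇒≢ i<j (trans (sym (opts-sound k i l∈)) (opts-sound k j l∈′))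

trees-unique : ∀ k n → Unique (treesWithin m k n)
opts-unique  : ∀ k n → Unique (optsWithin m k n)
trees-unique {m} k n = Unique.concat⁺
  (All.map⁺ (All.universal (λ i → Unique.map⁺ toNode-injective
    (Unique.cartesianProduct⁺ (Unique.allFin⁺ m)
      (Unique.cartesianProduct⁺ (opts-unique k i) (opts-unique k (n ∸ i))))) (upTo (suc n))))
  (AllPairs.map⁺ (AllPairs.applyUpTo⁺₁ (λ i → i) (suc n) λ i<j _ → layers-disjoint k n i<j))
opts-unique _       zero    = [] ∷ []
opts-unique zero    (suc n) = []
opts-unique (suc k) (suc n) = Unique.map⁺ just-injective (trees-unique k n)

∈𝓑⇔size : ∀ n (t : Tree m) → t ∈ 𝓑 m n ⇔ size t ≡ n
∈𝓑⇔size n t = mk⇔ (trees-sound n n) λ { refl → trees-complete n t ℕ.≤-refl }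

𝓑-unique : ∀ m n → Unique (𝓑 m n)
𝓑-unique m n = trees-unique n n

FPS : Set
FPS = ℕ → ℚ

infix  4 _≈_ _÷_≈_
infixl 6 _⊕_ _⊖_
infixl 7 _⊛_
infixr 8 _•_
infix  9 X^_ √_

_≈_ : FPS → FPS → Set
f ≈ g = ∀ n → f n ≡ g n

_⊕_ _⊖_ _⊛_ : FPS → FPS → FPS
(f ⊕ g) n = f n ℚ.+ g n
(f ⊖ g) n = f n ℚ.- g n
(f ⊛ g) n = ∑[ i ≤ n ] (f (toℕ i) ℚ.* g (n ∸ toℕ i))

_•_ : ℚ → FPS → FPS
(c • f) n = c ℚ.* f n

X^_ : ℕ → FPS
(X^ zero)  zero    = 1ℚ
(X^ zero)  (suc _) = 0ℚ
(X^ suc k) zero    = 0ℚ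
(X^ suc k) (suc n) = (X^ k) n

one : FPS
one = X^ 0

ι : ℕ → ℚ
ι n = + n ℚ./ 1

-- `f ÷ g ≈ h` says that h is the quotient f / g. For g ≉ 0 there is at most
-- one such h, and there is one only if g divides f: for g = c • X^ k this
-- forces the first k coefficients of f to vanish.
_÷_≈_ : (f g h : FPS) → Set
f ÷ g ≈ h = g ⊛ h ≈ f

-- `HasSum p₀ F S` says that ∑_{p ≥ p₀} F p converges to S in the topology of
-- formal power series: each coefficient of the partial sums is eventually
-- constant, with value the coefficient of S.
HasSum : ℕ → (ℕ → FPS) → FPS → Set
HasSum p₀ F S = ∀ n → ∃[ K ] ∀ P → K ≤ P → ∑[ i < P ] F (p₀ ℕ.+ toℕ i) n ≡ S n

-- For a series f with constant term 1, √ f is the square root of f with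
-- constant term 1 (see √-head, √-square and √-unique). The n-th iterate of
-- s ↦ s + ½ (f − s²) from 1 is correct up to its n-th coefficient.
refine : FPS → FPS → FPS
refine f s = s ⊕ ½ • (f ⊖ s ⊛ s)

approx : FPS → ℕ → FPS
approx f zero    = one
approx f (suc k) = refine f (approx f k)

√_ : FPS → FPS
(√ f) n = approx f n n

inner : FPS → ℕ → ℚ
inner s n = ∑[ i < n ] (s (suc (toℕ (inject₁ i))) ℚ.* s (n ∸ toℕ (inject₁ i)))

square-suc : ∀ s n → s 0 ≡ 1ℚ → (s ⊛ s) (suc n) ≡ s (suc n) ℚ.+ (inner s n ℚ.+ s (suc n))
square-suc s n s₀ = cong₂ ℚ._+_
  (trans (cong (ℚ._* s (suc n)) s₀) (ℚ.*-identityˡ (s (suc n))))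
  (trans (sum-init-last {n} (λ i → s (suc (toℕ i)) ℚ.* s (n ∸ toℕ i)))
    (cong (inner s n ℚ.+_) last≡))
  where
  last≡ : s (suc (toℕ (fromℕ n))) ℚ.* s (n ∸ toℕ (fromℕ n)) ≡ s (suc n)
  last≡ rewrite Fin.toℕ-fromℕ n | ℕ.n∸n≡0 n | s₀ = ℚ.*-identityʳ _

refine-suc : ∀ f s n → s 0 ≡ 1ℚ → refine f s (suc n) ≡ ½ ℚ.* (f (suc n) ℚ.- inner s n)
refine-suc f s n s₀ rewrite square-suc s n s₀ =
  solve 3 (λ x y z → x :+ con ½ :* (y :- (x :+ (z :+ x))) := con ½ :* (y :- z))
    refl (s (suc n)) (f (suc n)) (inner s n)
  where open +-*-Solver

refine-agree : ∀ f s t n → s 0 ≡ 1ℚ → t 0 ≡ 1ℚ → (∀ i → i ≤ n → s i ≡ t i) →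
               refine f s (suc n) ≡ refine f t (suc n)
refine-agree f s t n s₀ t₀ s≡t =
  trans (refine-suc f s n s₀) (trans (cong (λ z → ½ ℚ.* (f (suc n) ℚ.- z)) inner≡)
    (sym (refine-suc f t n t₀)))
  where
  inner≡ : inner s n ≡ inner t n
  inner≡ = sum-cong-≗ λ i → cong₂ ℚ._*_
    (s≡t (suc (toℕ (inject₁ i))) (subst (_< n) (sym (Fin.toℕ-inject₁ i)) (Fin.toℕ<n i)))
    (s≡t (n ∸ toℕ (inject₁ i)) (ℕ.m∸n≤m n (toℕ (inject₁ i))))

refine-head : ∀ f s → f 0 ≡ 1ℚ → s 0 ≡ 1ℚ → refine f s 0 ≡ 1ℚ
refine-head f s f₀ s₀ rewrite f₀ | s₀ = refl

approx-head : ∀ f → f 0 ≡ 1ℚ → ∀ k → approx f k 0 ≡ 1ℚ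
approx-head f f₀ zero    = refl
approx-head f f₀ (suc k) = refine-head f (approx f k) f₀ (approx-head f f₀ k)

approx-step : ∀ f → f 0 ≡ 1ℚ → ∀ k i → i ≤ k → approx f (suc k) i ≡ approx f k i
approx-step f f₀ k zero i≤k = trans (approx-head f f₀ (suc k)) (sym (approx-head f f₀ k))
approx-step f f₀ (suc k) (suc i) (s≤s i≤k) =
  refine-agree f _ _ i (approx-head f f₀ (suc k)) (approx-head f f₀ k)
    λ j j≤i → approx-step f f₀ k j (ℕ.≤-trans j≤i i≤k)

approx-stable : ∀ f → f 0 ≡ 1ℚ → ∀ d i → approx f (d ℕ.+ i) i ≡ (√ f) i
approx-stable f f₀ zero    i = refl
approx-stable f f₀ (suc d) i =
  trans (approx-step f f₀ (d ℕ.+ i) i (ℕ.m≤n+m i d)) (approx-stable f f₀ d i)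

√-fixed : ∀ f → f 0 ≡ 1ℚ → refine f (√ f) ≈ √ f
√-fixed f f₀ zero    = refine-head f (√ f) f₀ refl
√-fixed f f₀ (suc n) = refine-agree f (√ f) (approx f n) n refl (approx-head f f₀ n)
  λ i i≤n → sym (subst (λ k → approx f k i ≡ (√ f) i) (ℕ.m∸n+n≡m i≤n)
                   (approx-stable f f₀ (n ∸ i) i))

fixed⇒root : ∀ x y z → x ℚ.+ ½ ℚ.* (y ℚ.- z) ≡ x → z ≡ y
fixed⇒root x y z eq = begin
  z                                                          ≡⟨ solve 3 (λ x y z → z := y :- (con (ι 2) :* ((x :+ con ½ :* (y :- z)) :- x))) refl x y z ⟩
  y ℚ.- (ι 2 ℚ.* ((x ℚ.+ ½ ℚ.* (y ℚ.- z)) ℚ.- x))            ≡⟨ cong (λ w → y ℚ.- (ι 2 ℚ.* (w ℚ.- x))) eq ⟩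
  y ℚ.- (ι 2 ℚ.* (x ℚ.- x))                                  ≡⟨ solve 2 (λ x y → y :- (con (ι 2) :* (x :- x)) := y) refl x y ⟩
  y                                                          ∎
  where
  open ≡-Reasoning
  open +-*-Solver

root⇒fixed : ∀ f s → s ⊛ s ≈ f → refine f s ≈ s
root⇒fixed f s s² n = trans (cong (λ z → s n ℚ.+ ½ ℚ.* (f n ℚ.- z)) (s² n))
  (solve 2 (λ x y → x :+ con ½ :* (y :- y) := x) refl (s n) (f n))
  where open +-*-Solver

√-head : ∀ f → (√ f) 0 ≡ 1ℚ
√-head f = refl

√-square : ∀ f → f 0 ≡ 1ℚ → √ f ⊛ √ f ≈ f
√-square f f₀ n = fixed⇒root ((√ f) n) (f n) _ (√-fixed f f₀ n)

√-unique : ∀ f s → s 0 ≡ 1ℚ → s ⊛ s ≈ f → s ≈ √ f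
√-unique f s s₀ s² = <-rec _ go
  where
  f₀ : f 0 ≡ 1ℚ
  f₀ = trans (sym (s² 0)) (cong (λ x → x ℚ.* x ℚ.+ 0ℚ) s₀)
  go : ∀ n → (∀ {i} → i < n → s i ≡ (√ f) i) → s n ≡ (√ f) n
  go zero    _  = s₀
  go (suc n) ih = trans (sym (root⇒fixed f s s² (suc n)))
    (trans (refine-agree f s (√ f) n s₀ refl (λ i i≤n → ih (s≤s i≤n))) (√-fixed f f₀ (suc n)))

𝐍 𝐄 : ℕ → FPS
𝐍 m n = ι (sum (map ‖dag_‖ (𝓑 m n)))
𝐄 m n = ι (sum (map ∣dag_∣ (𝓑 m n)))

B : ℕ → ℕ → ℚ
B m p = (+ 1 ℚ./ (2 ℕ.+ p)) ℚ.* ι ((2 ℕ.* p ℕ.+ 2) C (p ℕ.+ 1)) ℚ.* ι (m ℕ.^ (p ℕ.+ 1))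

{-# OPTIONS --safe #-}
module Submission where

open import Defs
open import Algebra.Bundles using (CommutativeRing)
open import Data.Bool.Base using (true; false; if_then_else_)
open import Data.Fin.Base using (toℕ)
import Data.Fin.Properties as Fin
open import Data.Integer.Base as ℤ using (+_)
import Data.Integer.Properties as ℤ
open import Data.List.Base using (List; []; _∷_; _++_; map; length; concat; concatMap; cartesianProduct; allFin; upTo; applyUpTo; filter)
open import Data.List.Membership.Propositional using (_∈_; _∉_; lose)
open import Data.List.Membership.Propositional.Properties
  using (∈-concatMap⁺; ∈-upTo⁺; ∈-++⁺ˡ; ∈-++⁺ʳ; ∈-++⁻; ∈-filter⁺; ∈-filter⁻; ∈-deduplicate⁺; ∈-deduplicate⁻)
open import Data.List.Membership.Propositional.Properties.WithK using (unique∧set⇒bag)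
open import Data.List.Properties using (map-cong-local; length-tabulate)
open import Data.List.Relation.Binary.BagAndSetEquality using (∼bag⇒↭)
open import Data.List.Relation.Binary.Permutation.Propositional as ↭ using (_↭_)
open import Data.List.Relation.Unary.All as All using ()
import Data.List.Relation.Unary.All.Properties as All
import Data.List.Relation.Unary.AllPairs.Properties as AllPairs
open import Data.List.Relation.Unary.AllPairs using ([]; _∷_)
open import Data.List.Relation.Unary.Any using (here; there)
open import Data.List.Relation.Unary.Unique.Propositional using (Unique)
import Data.List.Relation.Unary.Unique.Propositional.Properties as Unique
open import Data.List.Relation.Unary.Unique.DecPropositional.Properties using (deduplicate-!)
open import Data.Maybe.Base using (Maybe; just)
open import Data.Nat.Base as ℕ using (ℕ; zero; suc; _+_; _*_; _∸_; _<_; _≤_; s≤s; z≤n; NonZero; _!)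
open import Data.Nat.Combinatorics using (_C_; nCk≡n!/k![n-k]!; k![n∸k]!∣n!)
import Data.Nat.DivMod as ℕ
open import Data.Nat.ListAction using (sum)
import Data.Nat.Properties as ℕ
open import Data.Nat.Solver renaming (module +-*-Solver to ℕ-Solver)
open import Data.Product using (_×_; _,_; proj₁; proj₂; ∃-syntax)
open import Data.Rational.Base as ℚ using (ℚ; 0ℚ; 1ℚ)
import Data.Rational.Properties as ℚ
open import Data.Rational.Solver using (module +-*-Solver)
open import Data.Rational.Unnormalised.Base as ℚᵘ using (_≃_; *≡*)
import Data.Rational.Unnormalised.Properties as ℚᵘ
open import Data.Sum.Base using (inj₁; inj₂; [_,_]′)
open import Function.Base using (_∘_; const)
open import Function.Bundles using (mk⇔)
open import Level using (Level)
open import Relation.Binary.PropositionalEquality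
open import Relation.Nullary.Decidable using (Dec; yes; no; does)
open import Relation.Nullary.Negation using (¬_; contradiction)
open import Relation.Unary using (Pred; Decidable)

open import Algebra.Properties.Semiring.Sum (CommutativeRing.semiring ℚ.+-*-commutativeRing)
  using (sum-syntax; sum⁺-syntax; sum-cong-≗; sum-replicate-zero; ∑-distrib-+; *-distribˡ-sum)

-- The trees avoiding a fixed subtree u are counted like all trees, except that
-- u itself is left out: the series G of optional trees without u satisfies
-- G = 1 + m z G² - z^(|u|+1), a quadratic equation with discriminant
-- 1 - 4 m z + 4 m z^(|u|+2). Hence (√(1 - 4 m z + 4 m z^(|u|+2)) - √(1 - 4 m z)) / (2 m z²)
-- counts the trees containing u, and it depends on |u| only. Summing over u
-- with weight 1, respectively with the number of children of u, counts each
-- tree once per node, respectively once per edge, of its dag.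

-- Two more ingredients give the explicit coefficients. The series T of all optional trees satisfies
-- T = 1 + m z T², so s = 1 - 2 m z T has s² = 1 - 4 m z. Applying z d/dz yields a linear relation
-- between s and its derivative, hence (n+2) T_{n+1} = (4n+2) m T_n. This is m times the ratio of
-- the binomial coefficients in B_{m,p}, divided by p+2. The same recurrence produces 3p/(2p+1): the
-- roots of the trees of size p have 2 (T_{p+1} - m T_p) children in total, and T_p can be
-- eliminated. No infinite sum over u is formed. A tree of size n has only subtrees of size at most
-- n, so for each coefficient a finite list of candidates u suffices, and every longer list gives
-- the same value; this is the convergence of the series over p. Square roots are recognized by
-- their square and their constant term 1. Division by 2 m z² is avoided by declaring the
-- denominator times `𝐍 m`, or a third of that times `𝐄 m`, to be the limit.

private
  variable
    a : Level
    A B′ : Set a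
    m : ℕ

-- Natural numbers and fractions inside `ℚ`

toℚᵘ-/ : ∀ a d .{{_ : NonZero d}} → ℚ.toℚᵘ (+ a ℚ./ d) ≃ (+ a ℚᵘ./ d)
toℚᵘ-/ a (suc d) = ℚ.toℚᵘ-fromℚᵘ (+ a ℚᵘ./ suc d)

ι-+ : ∀ a b → ι (a ℕ.+ b) ≡ ι a ℚ.+ ι b
ι-+ a b = ℚ.toℚᵘ-injective (begin
  ℚ.toℚᵘ (ι (a ℕ.+ b))            ≈⟨ toℚᵘ-/ (a ℕ.+ b) 1 ⟩
  + (a ℕ.+ b) ℚᵘ./ 1              ≈⟨ *≡* (cong (ℤ._* + 1) (sym (cong₂ ℤ._+_ (ℤ.*-identityʳ (+ a)) (ℤ.*-identityʳ (+ b))))) ⟩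
  + a ℚᵘ./ 1 ℚᵘ.+ + b ℚᵘ./ 1      ≈⟨ ℚᵘ.+-cong (toℚᵘ-/ a 1) (toℚᵘ-/ b 1) ⟨
  ℚ.toℚᵘ (ι a) ℚᵘ.+ ℚ.toℚᵘ (ι b)  ≈⟨ ℚ.toℚᵘ-homo-+ (ι a) (ι b) ⟨
  ℚ.toℚᵘ (ι a ℚ.+ ι b)            ∎)
  where open ℚᵘ.≃-Reasoning

ι-* : ∀ a b → ι (a ℕ.* b) ≡ ι a ℚ.* ι b
ι-* a b = ℚ.toℚᵘ-injective (begin
  ℚ.toℚᵘ (ι (a ℕ.* b))            ≈⟨ toℚᵘ-/ (a ℕ.* b) 1 ⟩
  + (a ℕ.* b) ℚᵘ./ 1              ≈⟨ *≡* (cong (ℤ._* + 1) (ℤ.pos-* a b)) ⟩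
  + a ℚᵘ./ 1 ℚᵘ.* (+ b ℚᵘ./ 1)    ≈⟨ ℚᵘ.*-cong (toℚᵘ-/ a 1) (toℚᵘ-/ b 1) ⟨
  ℚ.toℚᵘ (ι a) ℚᵘ.* ℚ.toℚᵘ (ι b)  ≈⟨ ℚ.toℚᵘ-homo-* (ι a) (ι b) ⟨
  ℚ.toℚᵘ (ι a ℚ.* ι b)            ∎)
  where open ℚᵘ.≃-Reasoning

/-ι : ∀ a d .{{_ : NonZero d}} → (+ a ℚ./ d) ℚ.* ι d ≡ ι a
/-ι a d@(suc _) = ℚ.toℚᵘ-injective (begin
  ℚ.toℚᵘ ((+ a ℚ./ d) ℚ.* ι d)          ≈⟨ ℚ.toℚᵘ-homo-* (+ a ℚ./ d) (ι d) ⟩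
  ℚ.toℚᵘ (+ a ℚ./ d) ℚᵘ.* ℚ.toℚᵘ (ι d)  ≈⟨ ℚᵘ.*-cong (toℚᵘ-/ a d) (toℚᵘ-/ d 1) ⟩
  (+ a ℚᵘ./ d) ℚᵘ.* (+ d ℚᵘ./ 1)        ≈⟨ *≡* (trans (ℤ.*-identityʳ (+ a ℤ.* + d)) (cong (λ x → + a ℤ.* + x) (sym (ℕ.*-identityʳ d)))) ⟩
  + a ℚᵘ./ 1                            ≈⟨ toℚᵘ-/ a 1 ⟨
  ℚ.toℚᵘ (ι a)                          ∎)
  where open ℚᵘ.≃-Reasoning

open ≡-Reasoning

ι-cancel : ∀ d .{{_ : NonZero d}} {x y} → ι d ℚ.* x ≡ ι d ℚ.* y → x ≡ y
ι-cancel d {x} {y} eq = begin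
  x                            ≡⟨ expand x ⟩
  (+ 1 ℚ./ d) ℚ.* (ι d ℚ.* x)  ≡⟨ cong ((+ 1 ℚ./ d) ℚ.*_) eq ⟩
  (+ 1 ℚ./ d) ℚ.* (ι d ℚ.* y)  ≡⟨ expand y ⟨
  y                            ∎
  where
  expand : ∀ z → z ≡ (+ 1 ℚ./ d) ℚ.* (ι d ℚ.* z)
  expand z = begin
    z                            ≡⟨ ℚ.*-identityˡ z ⟨
    1ℚ ℚ.* z                     ≡⟨ cong (ℚ._* z) (/-ι 1 d) ⟨
    (+ 1 ℚ./ d) ℚ.* ι d ℚ.* z    ≡⟨ ℚ.*-assoc (+ 1 ℚ./ d) (ι d) z ⟩
    (+ 1 ℚ./ d) ℚ.* (ι d ℚ.* z)  ∎

-- Central binomial coefficients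

central : ℕ → ℕ
central p = (2 ℕ.* p ℕ.+ 2) C (p ℕ.+ 1)

module _ where
  open ℕ-Solver using (solve; con; _:+_; _:*_; _:=_)

  central-! : ∀ p → central p ℕ.* (suc p ! ℕ.* suc p !) ≡ (2 ℕ.* p ℕ.+ 2) !
  central-! p = begin
    central p ℕ.* (suc p ! ℕ.* suc p !)
      ≡⟨ cong₂ (λ j k → central p ℕ.* (j ! ℕ.* k !)) (ℕ.+-comm 1 p) rest ⟩
    central p ℕ.* (k ! ℕ.* (n ∸ k) !)
      ≡⟨ cong (ℕ._* (k ! ℕ.* (n ∸ k) !)) (nCk≡n!/k![n-k]! k≤n) ⟩
    ((n !) ℕ./ (k ! ℕ.* (n ∸ k) !)) ℕ.* (k ! ℕ.* (n ∸ k) !)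
      ≡⟨ ℕ.m/n*n≡m (k![n∸k]!∣n! k≤n) ⟩
    n ! ∎
    where
    n = 2 ℕ.* p ℕ.+ 2
    k = p ℕ.+ 1
    instance
      _ = ℕ.m*n≢0 (k !) ((n ∸ k) !) {{k ℕ.!≢0}} {{(n ∸ k) ℕ.!≢0}}
    n≡k+k : n ≡ k ℕ.+ k
    n≡k+k = solve 1 (λ p → con 2 :* p :+ con 2 := (p :+ con 1) :+ (p :+ con 1)) refl p
    k≤n : k ≤ n
    k≤n = subst (k ≤_) (sym n≡k+k) (ℕ.m≤m+n k k)
    rest : suc p ≡ n ∸ k
    rest = trans (ℕ.+-comm 1 p) (sym (trans (cong (_∸ k) n≡k+k) (ℕ.m+n∸m≡n k k)))

  -- Multiplied by (p+2) (p+1)!², both sides become (2p+4)!.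
  central-suc : ∀ p → (2 ℕ.+ p) ℕ.* central (suc p) ≡ (4 ℕ.* suc p ℕ.+ 2) ℕ.* central p
  central-suc p = ℕ.*-cancelʳ-≡ _ _ ((2 ℕ.+ p) ℕ.* (f ℕ.* f)) {{nonZero}} (begin
    (2 ℕ.+ p) ℕ.* central (suc p) ℕ.* ((2 ℕ.+ p) ℕ.* (f ℕ.* f))
      ≡⟨ solve 3 (λ p c f →
           (con 2 :+ p) :* c :* ((con 2 :+ p) :* (f :* f)) := c :* (((con 2 :+ p) :* f) :* ((con 2 :+ p) :* f))) refl p (central (suc p)) f ⟩
    central (suc p) ℕ.* ((2 ℕ.+ p) ! ℕ.* (2 ℕ.+ p) !)
      ≡⟨ central-! (suc p) ⟩
    (2 ℕ.* suc p ℕ.+ 2) !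
      ≡⟨ cong (λ k → (k ℕ.+ 2) !) (ℕ.*-suc 2 p) ⟩
    (2 ℕ.+ n) ℕ.* ((1 ℕ.+ n) ℕ.* n !)
      ≡⟨ cong (λ x → (2 ℕ.+ n) ℕ.* ((1 ℕ.+ n) ℕ.* x)) (central-! p) ⟨
    (2 ℕ.+ n) ℕ.* ((1 ℕ.+ n) ℕ.* (central p ℕ.* (f ℕ.* f)))
      ≡⟨ solve 3 (λ p c f → let n = con 2 :* p :+ con 2 in
           (con 2 :+ n) :* ((con 1 :+ n) :* (c :* (f :* f)))
           := (con 4 :* (con 1 :+ p) :+ con 2) :* c :* ((con 2 :+ p) :* (f :* f))) refl p (central p) f ⟩
    (4 ℕ.* suc p ℕ.+ 2) ℕ.* central p ℕ.* ((2 ℕ.+ p) ℕ.* (f ℕ.* f)) ∎)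
    where
    n = 2 ℕ.* p ℕ.+ 2
    f = suc p !
    nonZero : NonZero ((2 ℕ.+ p) ℕ.* (f ℕ.* f))
    nonZero = ℕ.m*n≢0 (2 ℕ.+ p) (f ℕ.* f) {{_}} {{ℕ.m*n≢0 f f {{suc p ℕ.!≢0}} {{suc p ℕ.!≢0}}}}

-- Algebra of formal power series

open +-*-Solver using (solve; con; _:+_; _:*_; _:-_; :-_; _:=_)

-- The series (f - f(0)) / z. By definition `(f ⊛ g) (suc n)` is
-- `f 0 ℚ.* g (suc n) ℚ.+ (tl f ⊛ g) n`, which drives the inductions on coefficients below.
tl : FPS → FPS
tl f n = f (suc n)

⊛-cong : ∀ {f f′ g g′} → f ≈ f′ → g ≈ g′ → f ⊛ g ≈ f′ ⊛ g′
⊛-cong f≈ g≈ n = sum-cong-≗ {suc n} λ i → cong₂ ℚ._*_ (f≈ (toℕ i)) (g≈ (n ∸ toℕ i))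

⊛-distribʳ : ∀ f g h → (f ⊕ g) ⊛ h ≈ f ⊛ h ⊕ g ⊛ h
⊛-distribʳ f g h n = trans
  (sum-cong-≗ {suc n} λ i → ℚ.*-distribʳ-+ (h (n ∸ toℕ i)) (f (toℕ i)) (g (toℕ i)))
  (∑-distrib-+ {suc n} (λ i → f (toℕ i) ℚ.* h (n ∸ toℕ i)) (λ i → g (toℕ i) ℚ.* h (n ∸ toℕ i)))

•-⊛ : ∀ c f g → (c • f) ⊛ g ≈ c • (f ⊛ g)
•-⊛ c f g n = trans
  (sum-cong-≗ {suc n} λ i → ℚ.*-assoc c (f (toℕ i)) (g (n ∸ toℕ i)))
  (sym (*-distribˡ-sum {suc n} c (λ i → f (toℕ i) ℚ.* g (n ∸ toℕ i))))

-- The mirror image of the definitional unfolding: here the summand at the other end is split off.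
-- Playing the two against each other gives commutativity.
⊛-sucʳ : ∀ f g n → (f ⊛ g) (suc n) ≡ (f ⊛ tl g) n ℚ.+ f (suc n) ℚ.* g 0
⊛-sucʳ f g zero    = solve 2 (λ x y → x :+ (y :+ con 0ℚ) := (x :+ con 0ℚ) :+ y) refl (f 0 ℚ.* g 1) (f 1 ℚ.* g 0)
⊛-sucʳ f g (suc n) = trans (cong (λ x → f 0 ℚ.* g (2 ℕ.+ n) ℚ.+ x) (⊛-sucʳ (tl f) g n))
  (sym (ℚ.+-assoc (f 0 ℚ.* g (2 ℕ.+ n)) ((tl f ⊛ tl g) n) (f (2 ℕ.+ n) ℚ.* g 0)))

⊛-comm : ∀ f g → f ⊛ g ≈ g ⊛ f
⊛-comm f g zero    = cong (ℚ._+ 0ℚ) (ℚ.*-comm (f 0) (g 0))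
⊛-comm f g (suc n) = begin
  f 0 ℚ.* g (suc n) ℚ.+ (tl f ⊛ g) n  ≡⟨ cong₂ ℚ._+_ (ℚ.*-comm (f 0) (g (suc n))) (⊛-comm (tl f) g n) ⟩
  g (suc n) ℚ.* f 0 ℚ.+ (g ⊛ tl f) n  ≡⟨ ℚ.+-comm (g (suc n) ℚ.* f 0) ((g ⊛ tl f) n) ⟩
  (g ⊛ tl f) n ℚ.+ g (suc n) ℚ.* f 0  ≡⟨ ⊛-sucʳ g f n ⟨
  (g ⊛ f) (suc n)                     ∎

-- Induction on the coefficient with the series varying, because `tl (f ⊛ g)` is by definition
-- `f 0 • tl g ⊕ tl f ⊛ g`.
⊛-assoc : ∀ f g h → (f ⊛ g) ⊛ h ≈ f ⊛ (g ⊛ h)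
⊛-assoc f g h zero = solve 3 (λ x y z → (x :* y :+ con 0ℚ) :* z :+ con 0ℚ := x :* (y :* z :+ con 0ℚ) :+ con 0ℚ)
  refl (f 0) (g 0) (h 0)
⊛-assoc f g h (suc n) = begin
  (f 0 ℚ.* g 0 ℚ.+ 0ℚ) ℚ.* h (suc n) ℚ.+ ((f 0 • tl g ⊕ tl f ⊛ g) ⊛ h) n
    ≡⟨ cong (λ x → (f 0 ℚ.* g 0 ℚ.+ 0ℚ) ℚ.* h (suc n) ℚ.+ x) (begin
         ((f 0 • tl g ⊕ tl f ⊛ g) ⊛ h) n              ≡⟨ ⊛-distribʳ (f 0 • tl g) (tl f ⊛ g) h n ⟩
         ((f 0 • tl g) ⊛ h) n ℚ.+ ((tl f ⊛ g) ⊛ h) n  ≡⟨ cong₂ ℚ._+_ (•-⊛ (f 0) (tl g) h n) (⊛-assoc (tl f) g h n) ⟩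
         f 0 ℚ.* (tl g ⊛ h) n ℚ.+ (tl f ⊛ (g ⊛ h)) n  ∎) ⟩
  (f 0 ℚ.* g 0 ℚ.+ 0ℚ) ℚ.* h (suc n) ℚ.+ (f 0 ℚ.* (tl g ⊛ h) n ℚ.+ (tl f ⊛ (g ⊛ h)) n)
    ≡⟨ solve 5 (λ x y z u v → (x :* y :+ con 0ℚ) :* z :+ (x :* u :+ v) := x :* (y :* z :+ u) :+ v)
         refl (f 0) (g 0) (h (suc n)) ((tl g ⊛ h) n) ((tl f ⊛ (g ⊛ h)) n) ⟩
  f 0 ℚ.* (g 0 ℚ.* h (suc n) ℚ.+ (tl g ⊛ h) n) ℚ.+ (tl f ⊛ (g ⊛ h)) n ∎

zero-⊛ : ∀ f g → (∀ n → f n ≡ 0ℚ) → ∀ n → (f ⊛ g) n ≡ 0ℚ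
zero-⊛ f g f≈0 zero    = trans (cong (λ x → x ℚ.* g 0 ℚ.+ 0ℚ) (f≈0 0)) (cong (ℚ._+ 0ℚ) (ℚ.*-zeroˡ (g 0)))
zero-⊛ f g f≈0 (suc n) = cong₂ ℚ._+_
  (trans (cong (ℚ._* g (suc n)) (f≈0 0)) (ℚ.*-zeroˡ (g (suc n))))
  (zero-⊛ (tl f) g (λ k → f≈0 (suc k)) n)

linear-⊛ : ∀ f g → (∀ n → f (2 ℕ.+ n) ≡ 0ℚ) → ∀ n → (f ⊛ g) (suc n) ≡ f 0 ℚ.* g (suc n) ℚ.+ f 1 ℚ.* g n
linear-⊛ f g f≈0 zero    = cong (λ x → f 0 ℚ.* g 1 ℚ.+ x) (ℚ.+-identityʳ (f 1 ℚ.* g 0))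
linear-⊛ f g f≈0 (suc n) = cong (λ x → f 0 ℚ.* g (2 ℕ.+ n) ℚ.+ x)
  (trans (cong (λ x → f 1 ℚ.* g (suc n) ℚ.+ x) (zero-⊛ (tl (tl f)) g f≈0 n)) (ℚ.+-identityʳ (f 1 ℚ.* g (suc n))))

-- θ = z d/dz
θ : FPS → FPS
θ f n = ι n ℚ.* f n

-- Leibniz rule: in each summand of coefficient n the weight n splits as i + (n - i).
θ-⊛ : ∀ f g → θ (f ⊛ g) ≈ θ f ⊛ g ⊕ f ⊛ θ g
θ-⊛ f g n = begin
  ι n ℚ.* (f ⊛ g) n
    ≡⟨ *-distribˡ-sum {suc n} (ι n) (λ i → f (toℕ i) ℚ.* g (n ∸ toℕ i)) ⟩
  ∑[ i ≤ n ] (ι n ℚ.* (f (toℕ i) ℚ.* g (n ∸ toℕ i)))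
    ≡⟨ sum-cong-≗ {suc n} leibniz ⟩
  ∑[ i ≤ n ] (θ f (toℕ i) ℚ.* g (n ∸ toℕ i) ℚ.+ f (toℕ i) ℚ.* θ g (n ∸ toℕ i))
    ≡⟨ ∑-distrib-+ {suc n} (λ i → θ f (toℕ i) ℚ.* g (n ∸ toℕ i)) (λ i → f (toℕ i) ℚ.* θ g (n ∸ toℕ i)) ⟩
  (θ f ⊛ g) n ℚ.+ (f ⊛ θ g) n ∎
  where
  leibniz : ∀ i → ι n ℚ.* (f (toℕ i) ℚ.* g (n ∸ toℕ i)) ≡ θ f (toℕ i) ℚ.* g (n ∸ toℕ i) ℚ.+ f (toℕ i) ℚ.* θ g (n ∸ toℕ i)
  leibniz i = begin
    ι n ℚ.* (f j ℚ.* g k)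
      ≡⟨ cong (λ l → ι l ℚ.* (f j ℚ.* g k)) (ℕ.m+[n∸m]≡n (ℕ.≤-pred (Fin.toℕ<n i))) ⟨
    ι (j ℕ.+ k) ℚ.* (f j ℚ.* g k)
      ≡⟨ cong (ℚ._* (f j ℚ.* g k)) (ι-+ j k) ⟩
    (ι j ℚ.+ ι k) ℚ.* (f j ℚ.* g k)
      ≡⟨ solve 4 (λ a b x y → (a :+ b) :* (x :* y) := a :* x :* y :+ x :* (b :* y)) refl (ι j) (ι k) (f j) (g k) ⟩
    ι j ℚ.* f j ℚ.* g k ℚ.+ f j ℚ.* (ι k ℚ.* g k) ∎
    where
    j = toℕ i
    k = n ∸ toℕ i

-- From θg = 2 f θf, multiplied by f. The square of f is thereby replaced by g, leaving a relation
-- linear in f and θf.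
θ-square : ∀ f g → f ⊛ f ≈ g → θ g ⊛ f ≈ ι 2 • (g ⊛ θ f)
θ-square f g f² n = begin
  (θ g ⊛ f) n                              ≡⟨ ⊛-cong {g = f} θg (λ _ → refl) n ⟩
  ((θ f ⊛ f ⊕ θ f ⊛ f) ⊛ f) n              ≡⟨ ⊛-distribʳ (θ f ⊛ f) (θ f ⊛ f) f n ⟩
  ((θ f ⊛ f) ⊛ f) n ℚ.+ ((θ f ⊛ f) ⊛ f) n  ≡⟨ cong (λ x → x ℚ.+ x) (begin
    ((θ f ⊛ f) ⊛ f) n  ≡⟨ ⊛-assoc (θ f) f f n ⟩
    (θ f ⊛ (f ⊛ f)) n  ≡⟨ ⊛-cong {f = θ f} (λ _ → refl) f² n ⟩
    (θ f ⊛ g) n        ≡⟨ ⊛-comm (θ f) g n ⟩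
    (g ⊛ θ f) n        ∎) ⟩
  (g ⊛ θ f) n ℚ.+ (g ⊛ θ f) n  ≡⟨ solve 1 (λ x → x :+ x := con (ι 2) :* x) refl ((g ⊛ θ f) n) ⟩
  ι 2 ℚ.* (g ⊛ θ f) n          ∎
  where
  θg : θ g ≈ θ f ⊛ f ⊕ θ f ⊛ f
  θg k = begin
    ι k ℚ.* g k                  ≡⟨ cong (ι k ℚ.*_) (f² k) ⟨
    ι k ℚ.* (f ⊛ f) k            ≡⟨ θ-⊛ f f k ⟩
    (θ f ⊛ f) k ℚ.+ (f ⊛ θ f) k  ≡⟨ cong (λ x → (θ f ⊛ f) k ℚ.+ x) (⊛-comm f (θ f) k) ⟩
    (θ f ⊛ f) k ℚ.+ (θ f ⊛ f) k  ∎

-- Quadratic equations and square roots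

discriminant : ℚ → FPS → FPS
discriminant c d zero          = 1ℚ
discriminant c d (suc zero)    = ℚ.- (ι 4 ℚ.* c)
discriminant c d (suc (suc n)) = ι 4 ℚ.* c ℚ.* d n

-- If G = 1 + c z G² - z d, then 1 - 2 c z G is the square root of the
-- discriminant 1 - 4 c z + 4 c z² d of this quadratic equation.
root : ℚ → FPS → FPS
root c g zero    = 1ℚ
root c g (suc n) = ℚ.- (ι 2 ℚ.* c) ℚ.* g n

-- Completing the square: (1 - 2 c z G)² = 1 - 4 c z (G - c z G²), and the bracket equals 1 - z d by
-- the equation for G.
root-square : ∀ c g d → g 0 ≡ 1ℚ → (∀ n → g (suc n) ≡ c ℚ.* (g ⊛ g) n ℚ.- d n) →
              root c g ⊛ root c g ≈ discriminant c d
root-square c g d g₀ g₊ zero       = refl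
root-square c g d g₀ g₊ (suc zero) rewrite g₀ =
  solve 1 (λ c → con 1ℚ :* (:- (con (ι 2) :* c) :* con 1ℚ) :+ (:- (con (ι 2) :* c) :* con 1ℚ :* con 1ℚ :+ con 0ℚ)
                 := :- (con (ι 4) :* c)) refl c
root-square c g d g₀ g₊ (suc (suc n)) = begin
  1ℚ ℚ.* (k ℚ.* g (suc n)) ℚ.+ ((k • g) ⊛ root c g) (suc n)
    ≡⟨ cong (λ x → 1ℚ ℚ.* (k ℚ.* g (suc n)) ℚ.+ x) (begin
         ((k • g) ⊛ root c g) (suc n)                      ≡⟨ ⊛-sucʳ (k • g) (root c g) n ⟩
         ((k • g) ⊛ (k • g)) n ℚ.+ k ℚ.* g (suc n) ℚ.* 1ℚ  ≡⟨ cong (ℚ._+ k ℚ.* g (suc n) ℚ.* 1ℚ) (begin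
           ((k • g) ⊛ (k • g)) n    ≡⟨ •-⊛ k g (k • g) n ⟩
           k ℚ.* (g ⊛ (k • g)) n    ≡⟨ cong (k ℚ.*_) (⊛-comm g (k • g) n) ⟩
           k ℚ.* ((k • g) ⊛ g) n    ≡⟨ cong (k ℚ.*_) (•-⊛ k g g n) ⟩
           k ℚ.* (k ℚ.* (g ⊛ g) n)  ∎) ⟩
         k ℚ.* (k ℚ.* (g ⊛ g) n) ℚ.+ k ℚ.* g (suc n) ℚ.* 1ℚ  ∎) ⟩
  1ℚ ℚ.* (k ℚ.* g (suc n)) ℚ.+ (k ℚ.* (k ℚ.* (g ⊛ g) n) ℚ.+ k ℚ.* g (suc n) ℚ.* 1ℚ)
    ≡⟨ cong (λ x → 1ℚ ℚ.* (k ℚ.* x) ℚ.+ (k ℚ.* (k ℚ.* (g ⊛ g) n) ℚ.+ k ℚ.* x ℚ.* 1ℚ)) (g₊ n) ⟩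
  1ℚ ℚ.* (k ℚ.* (c ℚ.* (g ⊛ g) n ℚ.- d n)) ℚ.+ (k ℚ.* (k ℚ.* (g ⊛ g) n) ℚ.+ k ℚ.* (c ℚ.* (g ⊛ g) n ℚ.- d n) ℚ.* 1ℚ)
    ≡⟨ solve 3 (λ c x y → let k = :- (con (ι 2) :* c) in
         con 1ℚ :* (k :* (c :* x :- y)) :+ (k :* (k :* x) :+ k :* (c :* x :- y) :* con 1ℚ) := con (ι 4) :* c :* y)
         refl c ((g ⊛ g) n) (d n) ⟩
  ι 4 ℚ.* c ℚ.* d n ∎
  where
  k = ℚ.- (ι 2 ℚ.* c)

√-discriminant : ∀ m p → let h = one ⊖ ι (4 ℕ.* m) • X^ 1 ⊕ ι (4 ℕ.* m) • X^ (p ℕ.+ 2) in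
                 ∀ g → g 0 ≡ 1ℚ → (∀ n → g (suc n) ≡ ι m ℚ.* (g ⊛ g) n ℚ.- (X^ p) n) → root (ι m) g ≈ √ h
√-discriminant m p g g₀ g₊ = √-unique _ (root (ι m) g) refl
  λ n → trans (root-square (ι m) g (X^ p) g₀ g₊ n) (coeff n)
  where
  coeff : discriminant (ι m) (X^ p) ≈ one ⊖ ι (4 ℕ.* m) • X^ 1 ⊕ ι (4 ℕ.* m) • X^ (p ℕ.+ 2)
  -- `p ℕ.+ 2` is stuck on p, whereas `2 ℕ.+ p` lets `X^` compute at each of the coefficients split
  -- off here.
  coeff n rewrite ℕ.+-comm p 2 | ι-* 4 m with n
  ... | zero        = solve 1 (λ x → con 1ℚ := con 1ℚ :- x :* con 0ℚ :+ x :* con 0ℚ) refl (ι 4 ℚ.* ι m)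
  ... | suc zero    = solve 1 (λ x → :- x := con 0ℚ :- x :* con 1ℚ :+ x :* con 0ℚ) refl (ι 4 ℚ.* ι m)
  ... | suc (suc n) = solve 2 (λ x y → x :* y := con 0ℚ :- x :* con 0ℚ :+ x :* y) refl (ι 4 ℚ.* ι m) ((X^ p) n)

√-discriminant₀ : ∀ m → ∀ g → g 0 ≡ 1ℚ → (∀ n → g (suc n) ≡ ι m ℚ.* (g ⊛ g) n) →
                  root (ι m) g ≈ √ (one ⊖ ι (4 ℕ.* m) • X^ 1)
√-discriminant₀ m g g₀ g₊ = √-unique _ (root (ι m) g) refl
  λ n → trans (root-square (ι m) g (λ _ → 0ℚ) g₀ (λ k → trans (g₊ k) (sym (ℚ.+-identityʳ _))) n) (coeff n)
  where
  coeff : discriminant (ι m) (λ _ → 0ℚ) ≈ one ⊖ ι (4 ℕ.* m) • X^ 1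
  coeff n rewrite ι-* 4 m with n
  ... | zero        = solve 1 (λ x → con 1ℚ := con 1ℚ :- x :* con 0ℚ) refl (ι 4 ℚ.* ι m)
  ... | suc zero    = solve 1 (λ x → :- x := con 0ℚ :- x :* con 1ℚ) refl (ι 4 ℚ.* ι m)
  ... | suc (suc n) = solve 1 (λ x → x :* con 0ℚ := con 0ℚ :- x :* con 0ℚ) refl (ι 4 ℚ.* ι m)

-- Differentiating (1 - 2 c z G)² = 1 - 4 c z turns the quadratic recurrence
-- of G into a recurrence of order one.
catalan-recurrence : ∀ m .{{_ : NonZero m}} g → g 0 ≡ 1ℚ → (∀ n → g (suc n) ≡ ι m ℚ.* (g ⊛ g) n) →
                     ∀ n → ι (2 ℕ.+ n) ℚ.* g (suc n) ≡ ι (4 ℕ.* n ℕ.+ 2) ℚ.* ι m ℚ.* g n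
-- Comparing coefficients of z^(n+2) in `θ q ⊛ s ≈ ι 2 • (q ⊛ θ s)` gives the recurrence times 4m,
-- which is nonzero since m is.
catalan-recurrence m g g₀ g₊ n = ι-cancel (4 ℕ.* m) {{ℕ.m*n≢0 4 m}} (begin
  ι (4 ℕ.* m) ℚ.* (ι (2 ℕ.+ n) ℚ.* g (suc n))
    ≡⟨ cong₂ (λ x y → x ℚ.* (y ℚ.* g (suc n))) (ι-* 4 m) (ι-+ 2 n) ⟩
  ι 4 ℚ.* c ℚ.* ((ι 2 ℚ.+ ι n) ℚ.* g (suc n))
    -- Exposes the right side of `derivative` as a subterm, so that the next step can exchange it
    -- for the left side, in which `g (suc n)` has coefficient 0.
    ≡⟨ solve 4 (λ c x g g′ → con (ι 4) :* c :* ((con (ι 2) :+ x) :* g′)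
         := con (ι 16) :* c :* c :* (con 1ℚ :+ x) :* g :- con (ι 2) :* rhs c x g g′) refl c (ι n) (g n) (g (suc n)) ⟩
  ι 16 ℚ.* c ℚ.* c ℚ.* (1ℚ ℚ.+ ι n) ℚ.* g n ℚ.- ι 2 ℚ.* (1ℚ ℚ.* ((ι 2 ℚ.+ ι n) ℚ.* (k ℚ.* g (suc n))) ℚ.+ ℚ.- (ι 4 ℚ.* c) ℚ.* ((1ℚ ℚ.+ ι n) ℚ.* (k ℚ.* g n)))
    ≡⟨ cong (λ x → ι 16 ℚ.* c ℚ.* c ℚ.* (1ℚ ℚ.+ ι n) ℚ.* g n ℚ.- x) derivative ⟨
  ι 16 ℚ.* c ℚ.* c ℚ.* (1ℚ ℚ.+ ι n) ℚ.* g n ℚ.- (0ℚ ℚ.* (k ℚ.* g (suc n)) ℚ.+ ι 1 ℚ.* ℚ.- (ι 4 ℚ.* c) ℚ.* (k ℚ.* g n))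
    ≡⟨ solve 4 (λ c x g g′ → con (ι 16) :* c :* c :* (con 1ℚ :+ x) :* g :- lhs c g g′
         := con (ι 4) :* c :* ((con (ι 4) :* x :+ con (ι 2)) :* c :* g)) refl c (ι n) (g n) (g (suc n)) ⟩
  ι 4 ℚ.* c ℚ.* ((ι 4 ℚ.* ι n ℚ.+ ι 2) ℚ.* c ℚ.* g n)
    ≡⟨ cong₂ (λ x y → x ℚ.* (y ℚ.* c ℚ.* g n)) (ι-* 4 m) (trans (ι-+ (4 ℕ.* n) 2) (cong (ℚ._+ ι 2) (ι-* 4 n))) ⟨
  ι (4 ℕ.* m) ℚ.* (ι (4 ℕ.* n ℕ.+ 2) ℚ.* c ℚ.* g n) ∎)
  where
  c = ι m
  k = ℚ.- (ι 2 ℚ.* c)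
  s = root c g
  q = discriminant c (λ _ → 0ℚ)
  -- Solver images of the two sides of `derivative`, the right one without its leading factor 2.
  lhs = λ c g g′ → let k = :- (con (ι 2) :* c) in
    con 0ℚ :* (k :* g′) :+ con (ι 1) :* (:- (con (ι 4) :* c)) :* (k :* g)
  rhs = λ c x g g′ → let k = :- (con (ι 2) :* c) in
    con 1ℚ :* ((con (ι 2) :+ x) :* (k :* g′)) :+ (:- (con (ι 4) :* c)) :* ((con 1ℚ :+ x) :* (k :* g))
  q₊ : ∀ j → q (2 ℕ.+ j) ≡ 0ℚ
  q₊ j = ℚ.*-zeroʳ (ι 4 ℚ.* c)
  θq₊ : ∀ j → θ q (2 ℕ.+ j) ≡ 0ℚ
  θq₊ j = trans (cong (ι (2 ℕ.+ j) ℚ.*_) (q₊ j)) (ℚ.*-zeroʳ (ι (2 ℕ.+ j)))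
  derivative : 0ℚ ℚ.* (k ℚ.* g (suc n)) ℚ.+ ι 1 ℚ.* ℚ.- (ι 4 ℚ.* c) ℚ.* (k ℚ.* g n)
             ≡ ι 2 ℚ.* (1ℚ ℚ.* ((ι 2 ℚ.+ ι n) ℚ.* (k ℚ.* g (suc n))) ℚ.+ ℚ.- (ι 4 ℚ.* c) ℚ.* ((1ℚ ℚ.+ ι n) ℚ.* (k ℚ.* g n)))
  derivative = begin
    0ℚ ℚ.* (k ℚ.* g (suc n)) ℚ.+ ι 1 ℚ.* ℚ.- (ι 4 ℚ.* c) ℚ.* (k ℚ.* g n)  ≡⟨ linear-⊛ (θ q) s θq₊ (suc n) ⟨
    (θ q ⊛ s) (2 ℕ.+ n)                                                   ≡⟨ θ-square s q (root-square c g (λ _ → 0ℚ) g₀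
                                                                (λ j → trans (g₊ j) (sym (ℚ.+-identityʳ _)))) (2 ℕ.+ n) ⟩
    ι 2 ℚ.* (q ⊛ θ s) (2 ℕ.+ n)  ≡⟨ cong (ι 2 ℚ.*_) (linear-⊛ q (θ s) q₊ (suc n)) ⟩
    ι 2 ℚ.* (1ℚ ℚ.* (ι (2 ℕ.+ n) ℚ.* (k ℚ.* g (suc n))) ℚ.+ ℚ.- (ι 4 ℚ.* c) ℚ.* (ι (1 ℕ.+ n) ℚ.* (k ℚ.* g n)))
      ≡⟨ cong₂ (λ x y → ι 2 ℚ.* (1ℚ ℚ.* (x ℚ.* (k ℚ.* g (suc n))) ℚ.+ ℚ.- (ι 4 ℚ.* c) ℚ.* (y ℚ.* (k ℚ.* g n)))) (ι-+ 2 n) (ι-+ 1 n) ⟩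
    ι 2 ℚ.* (1ℚ ℚ.* ((ι 2 ℚ.+ ι n) ℚ.* (k ℚ.* g (suc n))) ℚ.+ ℚ.- (ι 4 ℚ.* c) ℚ.* ((1ℚ ℚ.+ ι n) ℚ.* (k ℚ.* g n))) ∎

-- Weighted sums over finite lists

total : (A → ℚ) → List A → ℚ
total f []       = 0ℚ
total f (x ∷ xs) = f x ℚ.+ total f xs

total-cong : ∀ {f g : A → ℚ} xs → (∀ {x} → x ∈ xs → f x ≡ g x) → total f xs ≡ total g xs
total-cong []       f≡g = refl
total-cong (x ∷ xs) f≡g = cong₂ ℚ._+_ (f≡g (here refl)) (total-cong xs (f≡g ∘ there))

total-zero : ∀ {f : A → ℚ} xs → (∀ {x} → x ∈ xs → f x ≡ 0ℚ) → total f xs ≡ 0ℚ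
total-zero []       f≡0 = refl
total-zero (x ∷ xs) f≡0 = cong₂ ℚ._+_ (f≡0 (here refl)) (total-zero xs (f≡0 ∘ there))

total-++ : ∀ (f : A → ℚ) xs ys → total f (xs ++ ys) ≡ total f xs ℚ.+ total f ys
total-++ f []       ys = sym (ℚ.+-identityˡ (total f ys))
total-++ f (x ∷ xs) ys = trans (cong (λ s → f x ℚ.+ s) (total-++ f xs ys)) (sym (ℚ.+-assoc (f x) (total f xs) (total f ys)))

total-map : ∀ (f : B′ → ℚ) (g : A → B′) xs → total f (map g xs) ≡ total (f ∘ g) xs
total-map f g []       = refl
total-map f g (x ∷ xs) = cong (λ s → f (g x) ℚ.+ s) (total-map f g xs)

total-concatMap : ∀ (f : B′ → ℚ) (g : A → List B′) xs → total f (concatMap g xs) ≡ total (total f ∘ g) xs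
total-concatMap f g []       = refl
total-concatMap f g (x ∷ xs) = trans (total-++ f (g x) (concatMap g xs)) (cong (λ s → total f (g x) ℚ.+ s) (total-concatMap f g xs))

total-applyUpTo : ∀ (f : A → ℚ) g n → total f (applyUpTo g n) ≡ ∑[ i < n ] f (g (toℕ i))
total-applyUpTo f g zero    = refl
total-applyUpTo f g (suc n) = cong (λ s → f (g 0) ℚ.+ s) (total-applyUpTo f (g ∘ suc) n)

total-+ : ∀ (f g : A → ℚ) xs → total (λ x → f x ℚ.+ g x) xs ≡ total f xs ℚ.+ total g xs
total-+ f g []       = refl
total-+ f g (x ∷ xs) = trans (cong (λ s → f x ℚ.+ g x ℚ.+ s) (total-+ f g xs))
  (solve 4 (λ a b c d → a :+ b :+ (c :+ d) := a :+ c :+ (b :+ d)) refl (f x) (g x) (total f xs) (total g xs))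

total-*ˡ : ∀ c (f : A → ℚ) xs → total (λ x → c ℚ.* f x) xs ≡ c ℚ.* total f xs
total-*ˡ c f []       = sym (ℚ.*-zeroʳ c)
total-*ˡ c f (x ∷ xs) = trans (cong (λ s → c ℚ.* f x ℚ.+ s) (total-*ˡ c f xs)) (sym (ℚ.*-distribˡ-+ c (f x) (total f xs)))

total-*ʳ : ∀ c (f : A → ℚ) xs → total (λ x → f x ℚ.* c) xs ≡ total f xs ℚ.* c
total-*ʳ c f xs = trans (total-cong xs (λ {x} _ → ℚ.*-comm (f x) c)) (trans (total-*ˡ c f xs) (ℚ.*-comm c (total f xs)))

total-swap : ∀ (f : A → B′ → ℚ) xs ys →
             total (λ x → total (f x) ys) xs ≡ total (λ y → total (λ x → f x y) xs) ys
total-swap f []       ys = sym (total-zero ys (λ _ → refl))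
total-swap f (x ∷ xs) ys = trans (cong (λ s → total (f x) ys ℚ.+ s) (total-swap f xs ys))
  (sym (total-+ (f x) (λ y → total (λ x → f x y) xs) ys))

total-cartesianProduct : ∀ (f : A → ℚ) (g : B′ → ℚ) xs ys →
  total (λ (x , y) → f x ℚ.* g y) (cartesianProduct xs ys) ≡ total f xs ℚ.* total g ys
total-cartesianProduct f g []       ys = sym (ℚ.*-zeroˡ (total g ys))
total-cartesianProduct f g (x ∷ xs) ys = begin
  total h (map (x ,_) ys ++ cartesianProduct xs ys)
    ≡⟨ total-++ h (map (x ,_) ys) (cartesianProduct xs ys) ⟩
  total h (map (x ,_) ys) ℚ.+ total h (cartesianProduct xs ys)
    ≡⟨ cong₂ ℚ._+_ (trans (total-map h (x ,_) ys) (total-*ˡ (f x) g ys)) (total-cartesianProduct f g xs ys) ⟩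
  f x ℚ.* total g ys ℚ.+ total f xs ℚ.* total g ys
    ≡⟨ ℚ.*-distribʳ-+ (total g ys) (f x) (total f xs) ⟨
  (f x ℚ.+ total f xs) ℚ.* total g ys ∎
  where
  h = λ (x , y) → f x ℚ.* g y

total-↭ : ∀ (f : A → ℚ) {xs ys} → xs ↭ ys → total f xs ≡ total f ys
total-↭ f ↭.refl = refl
total-↭ f (↭.prep x p) = cong (λ s → f x ℚ.+ s) (total-↭ f p)
total-↭ f (↭.swap {xs} {ys} x y p) = trans (cong (λ s → f x ℚ.+ (f y ℚ.+ s)) (total-↭ f p))
  (solve 3 (λ a b c → a :+ (b :+ c) := b :+ (a :+ c)) refl (f x) (f y) (total f ys))
total-↭ f (↭.trans p q) = trans (total-↭ f p) (total-↭ f q)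

total-one : ∀ (xs : List A) → total (const 1ℚ) xs ≡ ι (length xs)
total-one []       = refl
total-one (x ∷ xs) = trans (cong (λ s → 1ℚ ℚ.+ s) (total-one xs)) (sym (ι-+ 1 (length xs)))

ι-sum : ∀ (f : A → ℕ) xs → ι (sum (map f xs)) ≡ total (ι ∘ f) xs
ι-sum f []       = refl
ι-sum f (x ∷ xs) = trans (ι-+ (f x) (sum (map f xs))) (cong (λ s → ι (f x) ℚ.+ s) (ι-sum f xs))

-- Indicators and the avoidance of a subtree

⟦_⟧ : ∀ {P : Set a} → Dec P → ℚ
⟦ d ⟧ = if does d then 1ℚ else 0ℚ

⟦⟧-yes : ∀ {P : Set a} (d : Dec P) → P → ⟦ d ⟧ ≡ 1ℚ
⟦⟧-yes (yes _) p = refl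
⟦⟧-yes (no ¬p) p = contradiction p ¬p

⟦⟧-no : ∀ {P : Set a} (d : Dec P) → ¬ P → ⟦ d ⟧ ≡ 0ℚ
⟦⟧-no (yes p) ¬p = contradiction p ¬p
⟦⟧-no (no _)  ¬p = refl

⟦⟧-cong : ∀ {P Q : Set a} (d : Dec P) (e : Dec Q) → (P → Q) → (Q → P) → ⟦ d ⟧ ≡ ⟦ e ⟧
⟦⟧-cong (yes p) e P→Q Q→P = sym (⟦⟧-yes e (P→Q p))
⟦⟧-cong (no ¬p) e P→Q Q→P = sym (⟦⟧-no e (¬p ∘ Q→P))

total-filter : ∀ {p} {P : Pred A p} (P? : Decidable P) (f : A → ℚ) xs →
               total f (filter P? xs) ≡ total (λ x → f x ℚ.* ⟦ P? x ⟧) xs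
total-filter P? f [] = refl
total-filter P? f (x ∷ xs) with does (P? x)
... | true  = cong₂ ℚ._+_ (sym (ℚ.*-identityʳ (f x))) (total-filter P? f xs)
... | false = trans (total-filter P? f xs)
  (trans (sym (ℚ.+-identityˡ _)) (cong (ℚ._+ total (λ x → f x ℚ.* ⟦ P? x ⟧) xs) (sym (ℚ.*-zeroʳ (f x)))))

module _ {m : ℕ} where
  open import Data.List.Membership.DecPropositional (_≟_ {m}) public using (_∈?_)

∈?-∷-≢ : ∀ {u t : Tree m} ts → u ≢ t → ⟦ u ∈? (t ∷ ts) ⟧ ≡ ⟦ u ∈? ts ⟧
∈?-∷-≢ {u = u} {t} ts u≢t = ⟦⟧-cong (u ∈? (t ∷ ts)) (u ∈? ts)
  (λ { (here u≡t) → contradiction u≡t u≢t ; (there u∈) → u∈ }) there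

-- At most one entry of a repetition-free list can match, so counting matches amounts to testing
-- membership.
total-same : ∀ (u : Tree m) {ts} → Unique ts → total (λ t → ⟦ u ≟ t ⟧) ts ≡ ⟦ u ∈? ts ⟧
total-same u [] = refl
total-same u {t ∷ ts} (t∉ ∷ ts!) = head-or-tail (u ≟ t)
  where
  head-or-tail : Dec (u ≡ t) → ⟦ u ≟ t ⟧ ℚ.+ total (λ t → ⟦ u ≟ t ⟧) ts ≡ ⟦ u ∈? (t ∷ ts) ⟧
  head-or-tail (yes refl) = trans
    (cong₂ ℚ._+_ (⟦⟧-yes (u ≟ u) refl) (total-zero ts λ {x} x∈ → ⟦⟧-no (u ≟ x) (All.lookup t∉ x∈)))
    (sym (⟦⟧-yes (u ∈? (u ∷ ts)) (here refl)))
  head-or-tail (no u≢t) = trans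
    (cong₂ ℚ._+_ (⟦⟧-no (u ≟ t) u≢t) (total-same u ts!))
    (trans (ℚ.+-identityˡ ⟦ u ∈? ts ⟧) (sym (∈?-∷-≢ ts u≢t)))

avoids : Tree m → List (Tree m) → ℚ
avoids u ts = 1ℚ ℚ.- ⟦ u ∈? ts ⟧

-- This multiplicativity is what turns avoidance in both children into a convolution of series.
avoids-++ : ∀ (u : Tree m) ts us → avoids u (ts ++ us) ≡ avoids u ts ℚ.* avoids u us
avoids-++ u ts us with u ∈? ts | u ∈? us
... | yes u∈ | d      = trans (cong (λ x → 1ℚ ℚ.- x) (⟦⟧-yes (u ∈? (ts ++ us)) (∈-++⁺ˡ u∈)))
                          (sym (ℚ.*-zeroˡ (1ℚ ℚ.- ⟦ d ⟧)))
... | no _   | yes u∈ = cong (λ x → 1ℚ ℚ.- x) (⟦⟧-yes (u ∈? (ts ++ us)) (∈-++⁺ʳ ts u∈))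
... | no u∉  | no u∉′ = cong (λ x → 1ℚ ℚ.- x) (⟦⟧-no (u ∈? (ts ++ us)) λ u∈ → [ u∉ , u∉′ ]′ (∈-++⁻ ts u∈))

-- The two indicators differ only for u = t: then the tail avoids u, by `t ∉ ts`, while the whole
-- list does not.
avoids-∷ : ∀ (u t : Tree m) {ts} → t ∉ ts → avoids u (t ∷ ts) ℚ.+ ⟦ u ≟ t ⟧ ≡ avoids u ts
avoids-∷ u t {ts} t∉ = head-or-tail (u ≟ t)
  where
  head-or-tail : Dec (u ≡ t) → avoids u (t ∷ ts) ℚ.+ ⟦ u ≟ t ⟧ ≡ avoids u ts
  head-or-tail (yes refl) = trans
    (cong₂ (λ x y → 1ℚ ℚ.- x ℚ.+ y) (⟦⟧-yes (u ∈? (u ∷ ts)) (here refl)) (⟦⟧-yes (u ≟ u) refl))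
    (sym (cong (λ x → 1ℚ ℚ.- x) (⟦⟧-no (u ∈? ts) t∉)))
  head-or-tail (no u≢t) = trans
    (cong₂ (λ x y → 1ℚ ℚ.- x ℚ.+ y) (∈?-∷-≢ ts u≢t) (⟦⟧-no (u ≟ t) u≢t))
    (ℚ.+-identityʳ (avoids u ts))

subtrees-size  : ∀ (t : Tree m) {u} → u ∈ subtrees t → size u ≤ size t
subtreesᵐ-size : ∀ (o : Maybe (Tree m)) {u} → u ∈ subtreesᵐ o → size u < edges o
-- The strict inequality shows that no tree occurs among the subtrees of its own children.
children-size  : ∀ (l r : Maybe (Tree m)) {u} → u ∈ subtreesᵐ l ++ subtreesᵐ r → size u < edges l ℕ.+ edges r
subtrees-size (node a l r) (here refl) = ℕ.≤-refl
subtrees-size (node a l r) (there u∈)  = ℕ.<⇒≤ (children-size l r u∈)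
subtreesᵐ-size (just t) u∈ = s≤s (subtrees-size t u∈)
children-size l r u∈ with ∈-++⁻ (subtreesᵐ l) u∈
... | inj₁ u∈l = ℕ.<-≤-trans (subtreesᵐ-size l u∈l) (ℕ.m≤m+n (edges l) (edges r))
... | inj₂ u∈r = ℕ.<-≤-trans (subtreesᵐ-size r u∈r) (ℕ.m≤n+m (edges r) (edges l))

-- The equation for G tree by tree: u is the only tree that contains u while both its children avoid
-- u.
avoids-node : ∀ (u : Tree m) a l r → avoids u (subtrees (node a l r)) ℚ.+ ⟦ u ≟ node a l r ⟧
                                   ≡ avoids u (subtreesᵐ l) ℚ.* avoids u (subtreesᵐ r)
avoids-node u a l r = trans
  (avoids-∷ u (node a l r) (λ t∈ → ℕ.n≮n _ (children-size l r t∈)))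
  (avoids-++ u (subtreesᵐ l) (subtreesᵐ r))

-- The layers of `𝓑 m n` list the children with bound n, but a convolution needs factors that depend
-- on i or n - i alone.
trees-stable : ∀ k k′ n → n ≤ k → n ≤ k′ → treesWithin m k n ≡ treesWithin m k′ n
opts-stable  : ∀ k k′ n → n ≤ k → n ≤ k′ → optsWithin m k n ≡ optsWithin m k′ n
trees-stable {m} k k′ n n≤k n≤k′ = cong concat (map-cong-local (All.applyUpTo⁺₁ (λ i → i) (suc n) λ {i} i<1+n →
  cong₂ (λ ls rs → map toNode (cartesianProduct (allFin m) (cartesianProduct ls rs)))
    (opts-stable k k′ i (ℕ.≤-trans (ℕ.≤-pred i<1+n) n≤k) (ℕ.≤-trans (ℕ.≤-pred i<1+n) n≤k′))
    (opts-stable k k′ (n ∸ i) (ℕ.≤-trans (ℕ.m∸n≤m n i) n≤k) (ℕ.≤-trans (ℕ.m∸n≤m n i) n≤k′))))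
opts-stable zero    zero     zero    _         _          = refl
opts-stable zero    (suc k′) zero    _         _          = refl
opts-stable (suc k) zero     zero    _         _          = refl
opts-stable (suc k) (suc k′) zero    _         _          = refl
opts-stable (suc k) (suc k′) (suc n) (s≤s n≤k) (s≤s n≤k′) = cong (map just) (trees-stable k k′ n n≤k n≤k′)

-- Generating series of optional trees

opts : ∀ m (n : ℕ) → List (Maybe (Tree m))
opts m n = optsWithin m n n

-- Graded by `edges`: the empty child gives the constant term, and a tree of size n contributes in
-- degree n + 1.
gf : (Maybe (Tree m) → ℚ) → FPS
gf f n = total f (opts _ n)

-- The two child weights give the product of series, and the free choice of the label gives the
-- factor m.
total-𝓑 : ∀ (F : Tree m → ℚ) g h → (∀ a l r → F (node a l r) ≡ g l ℚ.* h r) →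
          ∀ n → total F (𝓑 m n) ≡ ι m ℚ.* (gf g ⊛ gf h) n
total-𝓑 {m} F g h F≡ n = begin
  total F (𝓑 m n)
    ≡⟨ total-concatMap F (layer m n n) (upTo (suc n)) ⟩
  total (total F ∘ layer m n n) (upTo (suc n))
    ≡⟨ total-applyUpTo (total F ∘ layer m n n) (λ i → i) (suc n) ⟩
  ∑[ i ≤ n ] total F (layer m n n (toℕ i))
    ≡⟨ sum-cong-≗ {suc n} (λ i → total-layer (toℕ i) (ℕ.≤-pred (Fin.toℕ<n i))) ⟩
  ∑[ i ≤ n ] (ι m ℚ.* (gf g (toℕ i) ℚ.* gf h (n ∸ toℕ i)))
    ≡⟨ *-distribˡ-sum {suc n} (ι m) (λ i → gf g (toℕ i) ℚ.* gf h (n ∸ toℕ i)) ⟨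
  ι m ℚ.* (gf g ⊛ gf h) n ∎
  where
  total-layer : ∀ i → i ≤ n → total F (layer m n n i) ≡ ι m ℚ.* (gf g i ℚ.* gf h (n ∸ i))
  total-layer i i≤n = begin
    total F (layer m n n i)
      ≡⟨ total-map F toNode (cartesianProduct (allFin m) (cartesianProduct ls rs)) ⟩
    total (F ∘ toNode) (cartesianProduct (allFin m) (cartesianProduct ls rs))
      -- The inserted `1ℚ` is the weight of the label; its sum over all labels is `ι m`.
      ≡⟨ total-cong (cartesianProduct (allFin m) (cartesianProduct ls rs))
           (λ { {a , l , r} _ → trans (F≡ a l r) (sym (ℚ.*-identityˡ (g l ℚ.* h r))) }) ⟩
    total (λ (a , lr) → 1ℚ ℚ.* (g (proj₁ lr) ℚ.* h (proj₂ lr))) (cartesianProduct (allFin m) (cartesianProduct ls rs))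
      ≡⟨ total-cartesianProduct (const 1ℚ) (λ lr → g (proj₁ lr) ℚ.* h (proj₂ lr)) (allFin m) (cartesianProduct ls rs) ⟩
    total (const 1ℚ) (allFin m) ℚ.* total (λ lr → g (proj₁ lr) ℚ.* h (proj₂ lr)) (cartesianProduct ls rs)
      ≡⟨ cong₂ ℚ._*_ (trans (total-one (allFin m)) (cong ι {y = m} (length-tabulate {n = m} (λ i → i))))
                   (total-cartesianProduct g h ls rs) ⟩
    ι m ℚ.* (total g ls ℚ.* total h rs)
      ≡⟨ cong₂ (λ ls rs → ι m ℚ.* (total g ls ℚ.* total h rs))
           (opts-stable n i i i≤n ℕ.≤-refl) (opts-stable n (n ∸ i) (n ∸ i) (ℕ.m∸n≤m n i) ℕ.≤-refl) ⟩
    ι m ℚ.* (gf g i ℚ.* gf h (n ∸ i)) ∎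
    where
    ls = optsWithin m n i
    rs = optsWithin m n (n ∸ i)

X^-self : ∀ p → (X^ p) p ≡ 1ℚ
X^-self zero    = refl
X^-self (suc p) = X^-self p

X^-≢ : ∀ p n → p ≢ n → (X^ p) n ≡ 0ℚ
X^-≢ zero    zero    p≢n = contradiction refl p≢n
X^-≢ zero    (suc n) p≢n = refl
X^-≢ (suc p) zero    p≢n = refl
X^-≢ (suc p) (suc n) p≢n = X^-≢ p n (p≢n ∘ cong suc)

total-same-𝓑 : ∀ (u : Tree m) n → total (λ t → ⟦ u ≟ t ⟧) (𝓑 m n) ≡ (X^ size u) n
total-same-𝓑 {m} u n = trans (total-same u (𝓑-unique m n)) (indicator (size u ℕ.≟ n))
  where
  indicator : Dec (size u ≡ n) → ⟦ u ∈? 𝓑 m n ⟧ ≡ (X^ size u) n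
  indicator (yes refl) = trans (⟦⟧-yes (u ∈? 𝓑 m n) (trees-complete n u ℕ.≤-refl)) (sym (X^-self n))
  indicator (no ≢n)    = trans (⟦⟧-no (u ∈? 𝓑 m n) (≢n ∘ trees-sound n n)) (sym (X^-≢ (size u) n ≢n))

-- The Catalan series evaluated at m z.
optional : ℕ → FPS
optional m = gf {m} (const 1ℚ)

optional-suc : ∀ m n → optional m (suc n) ≡ ι m ℚ.* (optional m ⊛ optional m) n
optional-suc m n = trans (total-map (const 1ℚ) just (𝓑 m n))
  (total-𝓑 {m} (const 1ℚ) (const 1ℚ) (const 1ℚ) (λ _ _ _ → refl) n)

avoiding : Tree m → FPS
avoiding u = gf (avoids u ∘ subtreesᵐ)

avoiding-suc : ∀ (u : Tree m) n → avoiding u (suc n) ≡ ι m ℚ.* (avoiding u ⊛ avoiding u) n ℚ.- (X^ size u) n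
avoiding-suc {m} u n = begin
  total (avoids u ∘ subtreesᵐ) (map just (𝓑 m n))
    ≡⟨ total-map (avoids u ∘ subtreesᵐ) just (𝓑 m n) ⟩
  total (avoids u ∘ subtrees) (𝓑 m n)
    -- Only together with the indicator of u does the weight factor over the children; taking it
    -- away again leaves the correction z^|u|.
    ≡⟨ solve 2 (λ x y → x := x :+ y :- y) refl (total (avoids u ∘ subtrees) (𝓑 m n)) (total (λ t → ⟦ u ≟ t ⟧) (𝓑 m n)) ⟩
  total (avoids u ∘ subtrees) (𝓑 m n) ℚ.+ total (λ t → ⟦ u ≟ t ⟧) (𝓑 m n) ℚ.- total (λ t → ⟦ u ≟ t ⟧) (𝓑 m n)
    ≡⟨ cong₂ ℚ._-_ (sym (total-+ (avoids u ∘ subtrees) (λ t → ⟦ u ≟ t ⟧) (𝓑 m n))) (total-same-𝓑 u n) ⟩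
  total (λ t → avoids u (subtrees t) ℚ.+ ⟦ u ≟ t ⟧) (𝓑 m n) ℚ.- (X^ size u) n
    ≡⟨ cong (ℚ._- (X^ size u) n) (total-𝓑 _ (avoids u ∘ subtreesᵐ) (avoids u ∘ subtreesᵐ) (avoids-node u) n) ⟩
  ι m ℚ.* (avoiding u ⊛ avoiding u) n ℚ.- (X^ size u) n ∎

-- Trees containing a fixed subtree

Δ : ℕ → ℕ → FPS
Δ m p = √ (one ⊖ ι (4 ℕ.* m) • X^ 1 ⊕ ι (4 ℕ.* m) • X^ (p ℕ.+ 2)) ⊖ √ (one ⊖ ι (4 ℕ.* m) • X^ 1)

containing : Tree m → FPS
containing u n = total (λ t → ⟦ u ∈? subtrees t ⟧) (𝓑 _ n)

optional-avoiding : ∀ (u : Tree m) n → optional m (suc n) ≡ avoiding u (suc n) ℚ.+ containing u n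
optional-avoiding {m} u n = begin
  optional m (suc n)
    ≡⟨ total-map (const 1ℚ) just (𝓑 m n) ⟩
  total (const 1ℚ) (𝓑 m n)
    ≡⟨ total-cong (𝓑 m n) (λ {t} _ → solve 1 (λ x → con 1ℚ := con 1ℚ :- x :+ x) refl ⟦ u ∈? subtrees t ⟧) ⟩
  total (λ t → avoids u (subtrees t) ℚ.+ ⟦ u ∈? subtrees t ⟧) (𝓑 m n)
    ≡⟨ total-+ (avoids u ∘ subtrees) (λ t → ⟦ u ∈? subtrees t ⟧) (𝓑 m n) ⟩
  total (avoids u ∘ subtrees) (𝓑 m n) ℚ.+ containing u n
    ≡⟨ cong (ℚ._+ containing u n) (total-map (avoids u ∘ subtreesᵐ) just (𝓑 m n)) ⟨
  avoiding u (suc n) ℚ.+ containing u n ∎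

Δ-root : ∀ (u : Tree m) n → Δ m (size u) n ≡ root (ι m) (avoiding u) n ℚ.- root (ι m) (optional m) n
Δ-root {m} u n = sym (cong₂ ℚ._-_
  (√-discriminant m (size u) (avoiding u) refl (avoiding-suc u) n)
  (√-discriminant₀ m (optional m) refl (optional-suc m) n))

-- The two roots differ by 2 m z times the difference of the optional series. The shift by 2
-- combines this z with the one by which a tree of size n sits in degree n + 1; it is the z² of the
-- denominator.
Δ-containing : ∀ (u : Tree m) n → Δ m (size u) (2 ℕ.+ n) ≡ ι 2 ℚ.* ι m ℚ.* containing u n
Δ-containing {m} u n = begin
  Δ m (size u) (2 ℕ.+ n)
    ≡⟨ Δ-root u (2 ℕ.+ n) ⟩
  ℚ.- (ι 2 ℚ.* ι m) ℚ.* avoiding u (suc n) ℚ.- ℚ.- (ι 2 ℚ.* ι m) ℚ.* optional m (suc n)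
    ≡⟨ cong (λ x → ℚ.- (ι 2 ℚ.* ι m) ℚ.* avoiding u (suc n) ℚ.- ℚ.- (ι 2 ℚ.* ι m) ℚ.* x) (optional-avoiding u n) ⟩
  ℚ.- (ι 2 ℚ.* ι m) ℚ.* avoiding u (suc n) ℚ.- ℚ.- (ι 2 ℚ.* ι m) ℚ.* (avoiding u (suc n) ℚ.+ containing u n)
    ≡⟨ solve 3 (λ c x y → (:- c) :* x :- (:- c) :* (x :+ y) := c :* y) refl (ι 2 ℚ.* ι m) (avoiding u (suc n)) (containing u n) ⟩
  ι 2 ℚ.* ι m ℚ.* containing u n ∎

-- Double counting over a finite set of candidate subtrees

treesBelow : ∀ m (P : ℕ) → List (Tree m)
treesBelow m P = concatMap (𝓑 m) (upTo P)

treesBelow-unique : ∀ m P → Unique (treesBelow m P)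
treesBelow-unique m P = Unique.concat⁺
  (All.map⁺ (All.universal (𝓑-unique m) (upTo P)))
  (AllPairs.map⁺ (AllPairs.applyUpTo⁺₁ (λ i → i) P λ {i} {j} i<j _ (t∈i , t∈j) →
    ℕ.<⇒≢ i<j (trans (sym (trees-sound i i t∈i)) (trees-sound j j t∈j))))

∈-treesBelow : ∀ {P} (t : Tree m) → size t < P → t ∈ treesBelow m P
∈-treesBelow {m} {P} t t<P = ∈-concatMap⁺ (𝓑 m) {xs = upTo P} (lose (∈-upTo⁺ t<P) (trees-complete (size t) t ℕ.≤-refl))

-- Two repetition-free lists with the same members; none is lost to the cutoff P, since subtrees are
-- no larger than t.
dagNodes-↭ : ∀ {P} (t : Tree m) → size t < P → filter (_∈? subtrees t) (treesBelow m P) ↭ dagNodes t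
dagNodes-↭ {m} {P} t t<P = ∼bag⇒↭ (unique∧set⇒bag
  (Unique.filter⁺ (_∈? subtrees t) (treesBelow-unique m P))
  (deduplicate-! _≟_ (subtrees t))
  (mk⇔ (λ u∈ → ∈-deduplicate⁺ _≟_ (proj₂ (∈-filter⁻ (_∈? subtrees t) {xs = treesBelow m P} u∈)))
       (λ u∈ → let u∈t = ∈-deduplicate⁻ _≟_ (subtrees t) u∈ in
          ∈-filter⁺ (_∈? subtrees t) (∈-treesBelow _ (ℕ.≤-<-trans (subtrees-size t u∈t) t<P)) u∈t)))

-- Double counting of the pairs (t , u) where u is a node of the dag of t.
total-dagNodes : ∀ (w : Tree m → ℚ) n P → n < P →
  ∑[ i < P ] (total w (𝓑 m (toℕ i)) ℚ.* Δ m (toℕ i) (2 ℕ.+ n)) ≡ ι 2 ℚ.* ι m ℚ.* total (total w ∘ dagNodes) (𝓑 m n)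
total-dagNodes {m} w n P n<P = begin
  ∑[ i < P ] (total w (𝓑 m (toℕ i)) ℚ.* Δ m (toℕ i) (2 ℕ.+ n))
    ≡⟨ total-applyUpTo (λ i → total w (𝓑 m i) ℚ.* Δ m i (2 ℕ.+ n)) (λ i → i) P ⟨
  total (λ i → total w (𝓑 m i) ℚ.* Δ m i (2 ℕ.+ n)) (upTo P)
    ≡⟨ total-cong (upTo P) (λ {i} _ → inner-total i) ⟩
  total (λ i → total (λ u → c ℚ.* (w u ℚ.* containing u n)) (𝓑 m i)) (upTo P)
    ≡⟨ total-concatMap (λ u → c ℚ.* (w u ℚ.* containing u n)) (𝓑 m) (upTo P) ⟨
  total (λ u → c ℚ.* (w u ℚ.* containing u n)) U
    ≡⟨ total-*ˡ c (λ u → w u ℚ.* containing u n) U ⟩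
  c ℚ.* total (λ u → w u ℚ.* containing u n) U
    ≡⟨ cong (c ℚ.*_) (total-cong U (λ {u} _ → sym (total-*ˡ (w u) (λ t → ⟦ u ∈? subtrees t ⟧) (𝓑 m n)))) ⟩
  c ℚ.* total (λ u → total (λ t → w u ℚ.* ⟦ u ∈? subtrees t ⟧) (𝓑 m n)) U
    ≡⟨ cong (c ℚ.*_) (total-swap (λ u t → w u ℚ.* ⟦ u ∈? subtrees t ⟧) U (𝓑 m n)) ⟩
  c ℚ.* total (λ t → total (λ u → w u ℚ.* ⟦ u ∈? subtrees t ⟧) U) (𝓑 m n)
    ≡⟨ cong (c ℚ.*_) (total-cong (𝓑 m n) λ {t} t∈ → trans
         (sym (total-filter (_∈? subtrees t) w U))
         (total-↭ w (dagNodes-↭ t (subst (_< P) (sym (trees-sound n n t∈)) n<P)))) ⟩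
  c ℚ.* total (total w ∘ dagNodes) (𝓑 m n) ∎
  where
  c = ι 2 ℚ.* ι m
  U = treesBelow m P
  inner-total : ∀ i → total w (𝓑 m i) ℚ.* Δ m i (2 ℕ.+ n) ≡ total (λ u → c ℚ.* (w u ℚ.* containing u n)) (𝓑 m i)
  inner-total i = begin
    total w (𝓑 m i) ℚ.* Δ m i (2 ℕ.+ n)
      ≡⟨ total-*ʳ (Δ m i (2 ℕ.+ n)) w (𝓑 m i) ⟨
    total (λ u → w u ℚ.* Δ m i (2 ℕ.+ n)) (𝓑 m i)
      ≡⟨ total-cong (𝓑 m i) (λ {u} u∈ → begin
           -- Every u in `𝓑 m i` has size i, so the common factor can be read as the count of trees
           -- containing that particular u.
           w u ℚ.* Δ m i (2 ℕ.+ n)         ≡⟨ cong (λ j → w u ℚ.* Δ m j (2 ℕ.+ n)) (trees-sound i i u∈) ⟨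
           w u ℚ.* Δ m (size u) (2 ℕ.+ n)  ≡⟨ cong (w u ℚ.*_) (Δ-containing u n) ⟩
           w u ℚ.* (c ℚ.* containing u n)  ≡⟨ solve 3 (λ x y z → x :* (y :* z) := y :* (x :* z)) refl (w u) c (containing u n) ⟩
           c ℚ.* (w u ℚ.* containing u n)  ∎) ⟩
    total (λ u → c ℚ.* (w u ℚ.* containing u n)) (𝓑 m i) ∎

-- The closed form of the number of trees

module _ (m : ℕ) .{{_ : NonZero m}} where

  optional-recurrence : ∀ n → ι (2 ℕ.+ n) ℚ.* optional m (suc n) ≡ ι (4 ℕ.* n ℕ.+ 2) ℚ.* ι m ℚ.* optional m n
  optional-recurrence = catalan-recurrence m (optional m) refl (optional-suc m)

  -- Both sides obey the same first-order recurrence, by `optional-recurrence` and `central-suc`;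
  -- the factor p + 2 aligns the two and is cancelled.
  optional-central : ∀ p → ι (2 ℕ.+ p) ℚ.* optional m (suc p) ≡ ι (central p) ℚ.* ι (m ℕ.^ (p ℕ.+ 1))
  optional-central zero = cong (ι 2 ℚ.*_) (begin
    optional m 1                ≡⟨ optional-suc m 0 ⟩
    ι m ℚ.* (1ℚ ℚ.* 1ℚ ℚ.+ 0ℚ)  ≡⟨ ℚ.*-identityʳ (ι m) ⟩
    ι m                         ≡⟨ cong ι (ℕ.*-identityʳ m) ⟨
    ι (m ℕ.^ 1)                 ∎)
  optional-central (suc p) = ι-cancel (2 ℕ.+ p) (begin
    ι (2 ℕ.+ p) ℚ.* (ι (3 ℕ.+ p) ℚ.* optional m (2 ℕ.+ p))
      ≡⟨ cong (ι (2 ℕ.+ p) ℚ.*_) (optional-recurrence (suc p)) ⟩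
    ι (2 ℕ.+ p) ℚ.* (ι k ℚ.* ι m ℚ.* optional m (suc p))
      ≡⟨ solve 4 (λ a b c d → a :* (b :* c :* d) := b :* c :* (a :* d)) refl (ι (2 ℕ.+ p)) (ι k) (ι m) (optional m (suc p)) ⟩
    ι k ℚ.* ι m ℚ.* (ι (2 ℕ.+ p) ℚ.* optional m (suc p))
      ≡⟨ cong (ι k ℚ.* ι m ℚ.*_) (optional-central p) ⟩
    ι k ℚ.* ι m ℚ.* (ι (central p) ℚ.* ι (m ℕ.^ (p ℕ.+ 1)))
      ≡⟨ solve 4 (λ a b c d → a :* b :* (c :* d) := (a :* c) :* (b :* d)) refl (ι k) (ι m) (ι (central p)) (ι (m ℕ.^ (p ℕ.+ 1))) ⟩
    (ι k ℚ.* ι (central p)) ℚ.* (ι m ℚ.* ι (m ℕ.^ (p ℕ.+ 1)))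
      ≡⟨ cong₂ ℚ._*_ (trans (sym (ι-* k (central p))) (trans (cong ι (sym (central-suc p))) (ι-* (2 ℕ.+ p) (central (suc p)))))
                   (sym (ι-* m (m ℕ.^ (p ℕ.+ 1)))) ⟩
    (ι (2 ℕ.+ p) ℚ.* ι (central (suc p))) ℚ.* ι (m ℕ.^ (suc p ℕ.+ 1))
      ≡⟨ ℚ.*-assoc (ι (2 ℕ.+ p)) (ι (central (suc p))) (ι (m ℕ.^ (suc p ℕ.+ 1))) ⟩
    ι (2 ℕ.+ p) ℚ.* (ι (central (suc p)) ℚ.* ι (m ℕ.^ (suc p ℕ.+ 1))) ∎)
    where
    k = 4 ℕ.* suc p ℕ.+ 2

  optional-B : ∀ p → optional m (suc p) ≡ B m p
  optional-B p = ι-cancel (2 ℕ.+ p) (begin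
    ι (2 ℕ.+ p) ℚ.* optional m (suc p)
      ≡⟨ optional-central p ⟩
    ι (central p) ℚ.* ι (m ℕ.^ (p ℕ.+ 1))
      ≡⟨ ℚ.*-identityˡ (ι (central p) ℚ.* ι (m ℕ.^ (p ℕ.+ 1))) ⟨
    ι 1 ℚ.* (ι (central p) ℚ.* ι (m ℕ.^ (p ℕ.+ 1)))
      ≡⟨ cong (ℚ._* (ι (central p) ℚ.* ι (m ℕ.^ (p ℕ.+ 1)))) (/-ι 1 (2 ℕ.+ p)) ⟨
    (+ 1 ℚ./ (2 ℕ.+ p)) ℚ.* ι (2 ℕ.+ p) ℚ.* (ι (central p) ℚ.* ι (m ℕ.^ (p ℕ.+ 1)))
      ≡⟨ solve 4 (λ a b c d → a :* b :* (c :* d) := b :* (a :* c :* d)) refl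
           (+ 1 ℚ./ (2 ℕ.+ p)) (ι (2 ℕ.+ p)) (ι (central p)) (ι (m ℕ.^ (p ℕ.+ 1))) ⟩
    ι (2 ℕ.+ p) ℚ.* B m p ∎)

  total-one-𝓑 : ∀ p → total (const 1ℚ) (𝓑 m p) ≡ B m p
  total-one-𝓑 p = trans (sym (total-map (const 1ℚ) just (𝓑 m p))) (optional-B p)

-- Children of the roots of all trees of a given size

one-⊛ : ∀ f → one ⊛ f ≈ f
one-⊛ f zero    = solve 1 (λ x → con 1ℚ :* x :+ con 0ℚ := x) refl (f 0)
one-⊛ f (suc n) = trans
  (cong (λ x → 1ℚ ℚ.* f (suc n) ℚ.+ x) (zero-⊛ (tl one) f (λ _ → refl) n))
  (solve 1 (λ x → con 1ℚ :* x :+ con 0ℚ := x) refl (f (suc n)))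

presence : ℕ → FPS
presence m = gf {m} (ι ∘ present)

optional-presence : ∀ m → optional m ≈ one ⊕ presence m
optional-presence m zero    = refl
optional-presence m (suc n) = begin
  optional m (suc n)         ≡⟨ total-map (const 1ℚ) just (𝓑 m n) ⟩
  total (const 1ℚ) (𝓑 m n)   ≡⟨ total-map (ι ∘ present) just (𝓑 m n) ⟨
  presence m (suc n)         ≡⟨ ℚ.+-identityˡ (presence m (suc n)) ⟨
  0ℚ ℚ.+ presence m (suc n)  ∎

-- Left and right children contribute equally. Trees with a non-empty left child have the series m
-- (T - 1) T = m T² - m T, and the coefficient of m T² is the next one of T.
total-children : ∀ m p → total (ι ∘ children) (𝓑 m p) ≡ ι 2 ℚ.* (optional m (suc p) ℚ.- ι m ℚ.* optional m p)
total-children m p = begin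
  total (ι ∘ children) (𝓑 m p)
    ≡⟨ total-cong (𝓑 m p) (λ { {node _ l r} _ → ι-+ (present l) (present r) }) ⟩
  total (λ t → left t ℚ.+ right t) (𝓑 m p)
    ≡⟨ total-+ left right (𝓑 m p) ⟩
  total left (𝓑 m p) ℚ.+ total right (𝓑 m p)
    ≡⟨ cong₂ ℚ._+_
         (total-𝓑 left (ι ∘ present) (const 1ℚ) (λ _ l _ → sym (ℚ.*-identityʳ (ι (present l)))) p)
         (total-𝓑 right (const 1ℚ) (ι ∘ present) (λ _ _ r → sym (ℚ.*-identityˡ (ι (present r)))) p) ⟩
  c ℚ.* (Q ⊛ T) p ℚ.+ c ℚ.* (T ⊛ Q) p
    ≡⟨ cong (λ x → c ℚ.* (Q ⊛ T) p ℚ.+ c ℚ.* x) (⊛-comm T Q p) ⟩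
  c ℚ.* (Q ⊛ T) p ℚ.+ c ℚ.* (Q ⊛ T) p
    ≡⟨ solve 3 (λ c x y → c :* x :+ c :* x := con (ι 2) :* (c :* (y :+ x) :- c :* y)) refl c ((Q ⊛ T) p) (T p) ⟩
  ι 2 ℚ.* (c ℚ.* (T p ℚ.+ (Q ⊛ T) p) ℚ.- c ℚ.* T p)
    ≡⟨ cong (λ x → ι 2 ℚ.* (c ℚ.* x ℚ.- c ℚ.* T p)) square ⟨
  ι 2 ℚ.* (c ℚ.* (T ⊛ T) p ℚ.- c ℚ.* T p)
    ≡⟨ cong (λ x → ι 2 ℚ.* (x ℚ.- c ℚ.* T p)) (optional-suc m p) ⟨
  ι 2 ℚ.* (T (suc p) ℚ.- c ℚ.* T p) ∎
  where
  c = ι m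
  T = optional m
  Q = presence m
  left right : Tree m → ℚ
  left  (node _ l _) = ι (present l)
  right (node _ _ r) = ι (present r)
  square : (T ⊛ T) p ≡ T p ℚ.+ (Q ⊛ T) p
  square = begin
    (T ⊛ T) p                  ≡⟨ ⊛-cong {g = T} (optional-presence m) (λ _ → refl) p ⟩
    ((one ⊕ Q) ⊛ T) p          ≡⟨ ⊛-distribʳ one Q T p ⟩
    (one ⊛ T) p ℚ.+ (Q ⊛ T) p  ≡⟨ cong (ℚ._+ (Q ⊛ T) p) (one-⊛ T p) ⟩
    T p ℚ.+ (Q ⊛ T) p          ∎

-- After multiplication by 2p + 1 the recurrence eliminates T_p, and (4p+2) - (p+2) = 3p remains as
-- the factor of T_{p+1}.
total-children-B : ∀ m .{{_ : NonZero m}} p →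
                   total (ι ∘ children) (𝓑 m p) ≡ ι 3 ℚ.* ((+ p ℚ./ suc (2 ℕ.* p)) ℚ.* B m p)
total-children-B m p = ι-cancel (suc (2 ℕ.* p)) (begin
  ι (suc (2 ℕ.* p)) ℚ.* total (ι ∘ children) (𝓑 m p)
    ≡⟨ cong₂ ℚ._*_ ι-odd (total-children m p) ⟩
  (1ℚ ℚ.+ ι 2 ℚ.* ι p) ℚ.* (ι 2 ℚ.* (T (suc p) ℚ.- ι m ℚ.* T p))
    ≡⟨ solve 4 (λ c x y z → (con 1ℚ :+ con (ι 2) :* x) :* (con (ι 2) :* (z :- c :* y))
         := (con (ι 4) :* x :+ con (ι 2)) :* z :- (con (ι 4) :* x :+ con (ι 2)) :* c :* y) refl (ι m) (ι p) (T p) (T (suc p)) ⟩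
  (ι 4 ℚ.* ι p ℚ.+ ι 2) ℚ.* T (suc p) ℚ.- (ι 4 ℚ.* ι p ℚ.+ ι 2) ℚ.* ι m ℚ.* T p
    ≡⟨ cong (λ x → (ι 4 ℚ.* ι p ℚ.+ ι 2) ℚ.* T (suc p) ℚ.- x) recurrence ⟨
  (ι 4 ℚ.* ι p ℚ.+ ι 2) ℚ.* T (suc p) ℚ.- (ι 2 ℚ.+ ι p) ℚ.* T (suc p)
    ≡⟨ solve 2 (λ x z → (con (ι 4) :* x :+ con (ι 2)) :* z :- (con (ι 2) :+ x) :* z := con (ι 3) :* (x :* z)) refl (ι p) (T (suc p)) ⟩
  ι 3 ℚ.* (ι p ℚ.* T (suc p))
    ≡⟨ cong₂ (λ x y → ι 3 ℚ.* (x ℚ.* y)) (sym (/-ι p (suc (2 ℕ.* p)))) (optional-B m p) ⟩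
  ι 3 ℚ.* ((+ p ℚ./ suc (2 ℕ.* p)) ℚ.* ι (suc (2 ℕ.* p)) ℚ.* B m p)
    ≡⟨ solve 4 (λ a b c d → a :* (b :* c :* d) := c :* (a :* (b :* d))) refl
         (ι 3) (+ p ℚ./ suc (2 ℕ.* p)) (ι (suc (2 ℕ.* p))) (B m p) ⟩
  ι (suc (2 ℕ.* p)) ℚ.* (ι 3 ℚ.* ((+ p ℚ./ suc (2 ℕ.* p)) ℚ.* B m p)) ∎)
  where
  T = optional m
  ι-odd : ι (suc (2 ℕ.* p)) ≡ 1ℚ ℚ.+ ι 2 ℚ.* ι p
  ι-odd = trans (ι-+ 1 (2 ℕ.* p)) (cong (λ x → 1ℚ ℚ.+ x) (ι-* 2 p))
  recurrence : (ι 2 ℚ.+ ι p) ℚ.* T (suc p) ≡ (ι 4 ℚ.* ι p ℚ.+ ι 2) ℚ.* ι m ℚ.* T p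
  recurrence = begin
    (ι 2 ℚ.+ ι p) ℚ.* T (suc p)            ≡⟨ cong (ℚ._* T (suc p)) (ι-+ 2 p) ⟨
    ι (2 ℕ.+ p) ℚ.* T (suc p)              ≡⟨ optional-recurrence m p ⟩
    ι (4 ℕ.* p ℕ.+ 2) ℚ.* ι m ℚ.* T p      ≡⟨ cong (λ x → x ℚ.* ι m ℚ.* T p) (trans (ι-+ (4 ℕ.* p) 2) (cong (ℚ._+ ι 2) (ι-* 4 p))) ⟩
    (ι 4 ℚ.* ι p ℚ.+ ι 2) ℚ.* ι m ℚ.* T p  ∎

-- Comparison of coefficients

𝐍-total : ∀ m n → 𝐍 m n ≡ total (total (const 1ℚ) ∘ dagNodes) (𝓑 m n)
𝐍-total m n = trans (ι-sum ‖dag_‖ (𝓑 m n)) (total-cong (𝓑 m n) λ {t} _ → sym (total-one (dagNodes t)))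

𝐄-total : ∀ m n → 𝐄 m n ≡ total (total (ι ∘ children) ∘ dagNodes) (𝓑 m n)
𝐄-total m n = trans (ι-sum ∣dag_∣ (𝓑 m n)) (total-cong (𝓑 m n) λ {t} _ → ι-sum children (dagNodes t))

X²-⊛ : ∀ c f n → ((c • X^ 2) ⊛ f) (2 ℕ.+ n) ≡ c ℚ.* f n
X²-⊛ c f n = begin
  c ℚ.* 0ℚ ℚ.* f (2 ℕ.+ n) ℚ.+ (c ℚ.* 0ℚ ℚ.* f (suc n) ℚ.+ ((c • one) ⊛ f) n)
    ≡⟨ cong (λ x → c ℚ.* 0ℚ ℚ.* f (2 ℕ.+ n) ℚ.+ (c ℚ.* 0ℚ ℚ.* f (suc n) ℚ.+ x)) (trans (•-⊛ c one f n) (cong (c ℚ.*_) (one-⊛ f n))) ⟩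
  c ℚ.* 0ℚ ℚ.* f (2 ℕ.+ n) ℚ.+ (c ℚ.* 0ℚ ℚ.* f (suc n) ℚ.+ c ℚ.* f n)
    ≡⟨ solve 4 (λ c x y z → c :* con 0ℚ :* x :+ (c :* con 0ℚ :* y :+ c :* z) := c :* z) refl c (f (2 ℕ.+ n)) (f (suc n)) (f n) ⟩
  c ℚ.* f n ∎

X²-⊛-low : ∀ c f n → n < 2 → ((c • X^ 2) ⊛ f) n ≡ 0ℚ
X²-⊛-low c f 0 _ = solve 2 (λ c x → c :* con 0ℚ :* x :+ con 0ℚ := con 0ℚ) refl c (f 0)
X²-⊛-low c f 1 _ = solve 3 (λ c x y → c :* con 0ℚ :* x :+ (c :* con 0ℚ :* y :+ con 0ℚ) := con 0ℚ) refl c (f 1) (f 0)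
X²-⊛-low c f (suc (suc _)) (s≤s (s≤s ()))

-- The radicands first differ in degree p + 2, so both roots begin with 1 - 2 m z. This is the
-- divisibility by z² that the quotient demands.
Δ-low : ∀ m p n → n < 2 → Δ m p n ≡ 0ℚ
Δ-low m p 0 _ = refl
Δ-low m p 1 _ rewrite ℕ.+-comm p 2 =
  -- The unfolded linear coefficients after a single `refine` from `one`.
  solve 1 (λ x → (con 0ℚ :+ con ℚ.½ :* ((con 0ℚ :- x :* con 1ℚ :+ x :* con 0ℚ) :- con 0ℚ))
              :- (con 0ℚ :+ con ℚ.½ :* ((con 0ℚ :- x :* con 1ℚ) :- con 0ℚ)) := con 0ℚ) refl (ι (4 ℕ.* m))
Δ-low m p (suc (suc _)) (s≤s (s≤s ()))

∑-Δ-low : ∀ m (c : ℕ → ℚ) (q : ℕ → ℕ) n → n < 2 → ∀ P → ∑[ i < P ] (c (toℕ i) ℚ.* Δ m (q (toℕ i)) n) ≡ 0ℚ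
∑-Δ-low m c q n n<2 P = trans
  (sum-cong-≗ {P} λ i → trans (cong (c (toℕ i) ℚ.*_) (Δ-low m (q (toℕ i)) n n<2)) (ℚ.*-zeroʳ (c (toℕ i))))
  (sum-replicate-zero P)

-- Degree n involves trees of size n - 2, so P ≥ n lists every possible subtree. The value from
-- `total-dagNodes` does not mention P, which gives the eventual constancy.
nodes-hasSum : ∀ m .{{_ : NonZero m}} →
               HasSum 0 (λ p → B m p • Δ m p) ((ι (2 ℕ.* m) • X^ 2) ⊛ 𝐍 m)
nodes-hasSum m n = n , λ P n≤P → coefficient n P n≤P
  where
  low : ∀ n → n < 2 → ∀ P → ∑[ i < P ] (B m (toℕ i) ℚ.* Δ m (toℕ i) n) ≡ ((ι (2 ℕ.* m) • X^ 2) ⊛ 𝐍 m) n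
  low n n<2 P = trans (∑-Δ-low m (B m) (λ i → i) n n<2 P) (sym (X²-⊛-low (ι (2 ℕ.* m)) (𝐍 m) n n<2))
  coefficient : ∀ n P → n ≤ P → ∑[ i < P ] (B m (toℕ i) ℚ.* Δ m (toℕ i) n) ≡ ((ι (2 ℕ.* m) • X^ 2) ⊛ 𝐍 m) n
  coefficient 0 P _ = low 0 (s≤s z≤n) P
  coefficient 1 P _ = low 1 (s≤s (s≤s z≤n)) P
  coefficient (suc (suc n)) P n<P = begin
    ∑[ i < P ] (B m (toℕ i) ℚ.* Δ m (toℕ i) (2 ℕ.+ n))
      ≡⟨ sum-cong-≗ {P} (λ i → cong (ℚ._* Δ m (toℕ i) (2 ℕ.+ n)) (total-one-𝓑 m (toℕ i))) ⟨
    ∑[ i < P ] (total (const 1ℚ) (𝓑 m (toℕ i)) ℚ.* Δ m (toℕ i) (2 ℕ.+ n))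
      ≡⟨ total-dagNodes {m} (const 1ℚ) n P (ℕ.<-trans (ℕ.n<1+n n) n<P) ⟩
    ι 2 ℚ.* ι m ℚ.* total (total (const 1ℚ) ∘ dagNodes) (𝓑 m n)
      ≡⟨ cong₂ ℚ._*_ (ι-* 2 m) (𝐍-total m n) ⟨
    ι (2 ℕ.* m) ℚ.* 𝐍 m n
      ≡⟨ X²-⊛ (ι (2 ℕ.* m)) (𝐍 m) n ⟨
    ((ι (2 ℕ.* m) • X^ 2) ⊛ 𝐍 m) (2 ℕ.+ n) ∎

third-cancel : ∀ x → ι 3 ℚ.* ((+ 1 ℚ./ 3) ℚ.* x) ≡ x
third-cancel = solve 1 (λ x → con (ι 3) :* (con (+ 1 ℚ./ 3) :* x) := x) refl

-- The third compensates for the prefactor 3 of the edge formula; coefficients are compared after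
-- multiplication by 3, where the weights are integral counts of children.
edges-hasSum : ∀ m .{{_ : NonZero m}} →
               HasSum 1 (λ p → ((+ p ℚ./ suc (2 ℕ.* p)) ℚ.* B m p) • Δ m p)
                 ((+ 1 ℚ./ 3) • ((ι (2 ℕ.* m) • X^ 2) ⊛ 𝐄 m))
edges-hasSum m n = n , λ P n≤P → ι-cancel 3 (trans (coefficient n P n≤P) (sym (third-cancel _)))
  where
  b : ℕ → ℚ
  b p = (+ p ℚ./ suc (2 ℕ.* p)) ℚ.* B m p
  low : ∀ n → n < 2 → ∀ P → ι 3 ℚ.* ∑[ i < P ] (b (suc (toℕ i)) ℚ.* Δ m (suc (toℕ i)) n) ≡ ((ι (2 ℕ.* m) • X^ 2) ⊛ 𝐄 m) n
  low n n<2 P = trans (cong (ι 3 ℚ.*_) (∑-Δ-low m (b ∘ suc) suc n n<2 P)) (sym (X²-⊛-low (ι (2 ℕ.* m)) (𝐄 m) n n<2))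
  coefficient : ∀ n P → n ≤ P → ι 3 ℚ.* ∑[ i < P ] (b (suc (toℕ i)) ℚ.* Δ m (suc (toℕ i)) n) ≡ ((ι (2 ℕ.* m) • X^ 2) ⊛ 𝐄 m) n
  coefficient 0 P _ = low 0 (s≤s z≤n) P
  coefficient 1 P _ = low 1 (s≤s (s≤s z≤n)) P
  coefficient (suc (suc n)) P n<P = begin
    ι 3 ℚ.* ∑[ i < P ] (b (suc (toℕ i)) ℚ.* δ (suc (toℕ i)))
      ≡⟨ *-distribˡ-sum {P} (ι 3) (λ i → b (suc (toℕ i)) ℚ.* δ (suc (toℕ i))) ⟩
    ∑[ i < P ] (ι 3 ℚ.* (b (suc (toℕ i)) ℚ.* δ (suc (toℕ i))))
      ≡⟨ sum-cong-≗ {P} (λ i → trans (cong (ℚ._* δ (suc (toℕ i))) (total-children-B m (suc (toℕ i))))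
                                     (ℚ.*-assoc (ι 3) (b (suc (toℕ i))) (δ (suc (toℕ i))))) ⟨
    ∑[ i < P ] (W (suc (toℕ i)) ℚ.* δ (suc (toℕ i)))
      -- The double count runs from p = 0. The missing summand is prepended as zero, since a
      -- one-node tree has no children; the range thus grows to `suc P`.
      ≡⟨ ℚ.+-identityˡ _ ⟨
    0ℚ ℚ.+ ∑[ i < P ] (W (suc (toℕ i)) ℚ.* δ (suc (toℕ i)))
      ≡⟨ cong (ℚ._+ ∑[ i < P ] (W (suc (toℕ i)) ℚ.* δ (suc (toℕ i)))) no-children ⟨
    ∑[ i < suc P ] (W (toℕ i) ℚ.* δ (toℕ i))
      ≡⟨ total-dagNodes {m} (ι ∘ children) n (suc P) (ℕ.<-trans (ℕ.n<1+n n) (ℕ.m≤n⇒m≤1+n n<P)) ⟩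
    ι 2 ℚ.* ι m ℚ.* total (total (ι ∘ children) ∘ dagNodes) (𝓑 m n)
      ≡⟨ cong₂ ℚ._*_ (ι-* 2 m) (𝐄-total m n) ⟨
    ι (2 ℕ.* m) ℚ.* 𝐄 m n
      ≡⟨ X²-⊛ (ι (2 ℕ.* m)) (𝐄 m) n ⟨
    ((ι (2 ℕ.* m) • X^ 2) ⊛ 𝐄 m) (2 ℕ.+ n) ∎
    where
    W δ : ℕ → ℚ
    W p = total (ι ∘ children) (𝓑 m p)
    δ p = Δ m p (2 ℕ.+ n)
    no-children : W 0 ℚ.* δ 0 ≡ 0ℚ
    no-children = trans (cong (ℚ._* δ 0) (trans (total-children-B m 0)
      (trans (cong (ι 3 ℚ.*_) (ℚ.*-zeroˡ (B m 0))) (ℚ.*-zeroʳ (ι 3))))) (ℚ.*-zeroˡ (δ 0))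

theorem5 : (m : ℕ) .{{_ : NonZero m}} →
    let Δ : ℕ → FPS
        Δ p = √ (one ⊖ ι (4 * m) • X^ 1 ⊕ ι (4 * m) • X^ (p + 2)) ⊖ √ (one ⊖ ι (4 * m) • X^ 1)
    in
      (∃[ S ] HasSum 0 (λ p → B m p • Δ p) S
            × S ÷ ι (2 * m) • X^ 2 ≈ 𝐍 m)
    × (∃[ S ] HasSum 1 (λ p → ((+ p ℚ./ suc (2 * p)) ℚ.* B m p) • Δ p) S
            × (ι 3 • S) ÷ ι (2 * m) • X^ 2 ≈ 𝐄 m)
theorem5 m =
    (_ , nodes-hasSum m , λ _ → refl)
  , (_ , edges-hasSum m , λ n → sym (third-cancel (((ι (2 * m) • X^ 2) ⊛ 𝐄 m) n)))
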